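{- There are infinitely many finite words $w\in\{0,1\}^*$ such that $$|\mathrm{Dict}(w)|\leq 1.9\sqrt{|w|}\quad\text{and}\quad |\mathrm{Dict}(0w)|\geq 0.039\,|w|^{3/4}.$$
   Context: The LZ'78 parsing of a finite binary word $w$ is the unique factorization $w=m_1m_2\cdots m_k$ into nonempty words (blocks) such that $m_1,\dots,m_{k-1}$ are pairwise distinct and, for every $i\le k$, every nonempty prefix of $m_i$ belongs to $\{m_1,\dots,m_i\}$. The dictionary is $\mathrm{Dict}(w)=\{m_1,\dots,m_k\}$. $0w$ is the word obtained by prepending the letter $0$ to $w$. -}

module Defs where

open import Data.Bool using (Bool; false; true)
open import Data.Bool.Properties using () renaming (_≟_ to _≟ᵇ_)
open import Data.List using (List; []; _∷_; _++_; length; concat; deduplicate)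
open import Data.List.Properties using (≡-dec)
open import Data.List.Membership.Propositional using (_∈_; _∉_)
open import Data.Product using (_×_; ∃)
open import Data.Unit using (⊤)
open import Relation.Binary.PropositionalEquality using (_≡_; _≢_)
open import Data.Nat using (ℕ)
open import Relation.Nullary using (Dec)

-- Finite binary words over the alphabet {0,1}; 0 is encoded as false, 1 as true.
Word : Set
Word = List Bool

_≟w_ : (u v : Word) → Dec (u ≡ v)
_≟w_ = ≡-dec _≟ᵇ_

_IsPrefixOf_ : Word → Word → Set
p IsPrefixOf m = ∃ λ s → p ++ s ≡ m

-- LZParse prev ms : the block list ms = m_i, ..., m_k continues an LZ'78 parsing
-- whose earlier blocks (most recent first) are prev = m_{i-1}, ..., m_1:
--  * every block is nonempty;
--  * every nonempty prefix of m_i lies in {m_1, ..., m_i};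
--  * every block other than the last one is distinct from all earlier blocks
--    (so m_1, ..., m_{k-1} are pairwise distinct).
LZParse : List Word → List Word → Set
LZParse prev [] = ⊤
LZParse prev (m ∷ rest) =
  (m ≢ [])
  × (∀ p → p ≢ [] → p IsPrefixOf m → p ∈ (m ∷ prev))
  × (rest ≢ [] → m ∉ prev)
  × LZParse (m ∷ prev) rest

IsLZ78Parsing : Word → List Word → Set
IsLZ78Parsing w ms = concat ms ≡ w × LZParse [] ms

dictSize : List Word → ℕ
dictSize ms = length (deduplicate _≟w_ ms)

{-# OPTIONS --safe #-}
module Submission where

-- Let x be an infinite word whose factors of length A are distinct up to a position of order A³, and X i its prefix of
-- length i.  The word w is a short preamble followed by the "lines" X 4, X 5, …, X n, with n of order A², and some
-- gadgets 1ⁱ in between.  All of these are blocks of w, so |Dict(w)| = O(n) while |w| is of order n².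
--
-- Up to the line X n₁ the parsers of w and 0w run in parallel.  Afterwards a gadget is inserted whenever the parser of
-- 0w completes a block exactly at the end of a line.  The preamble makes that parser lag by one on the blocks 1ⁱ, so it
-- reads the gadget 1ⁱ as 1ⁱ⁻¹ | 1X…, and hence none of the n₂ later lines starts at a block boundary of 0w.
--
-- As a long factor of X occurs at only one offset, a block of 0w starting at offset p ≥ 1 and longer than l forces
-- l - O(A) earlier lines in which a block starts at p, and thus as many blocks [q, p) with distinct q.  If l is large,
-- then the prefixes of these blocks ending shortly before p are more blocks across one position than there are lines.
-- So the blocks of 0w inside the later lines have length O(A + √n₂) = O(√n), which makes order n^(3/2) of them.

open import Defs
open import Data.Bool using (Bool; true; false)
open import Data.Empty using (⊥; ⊥-elim)
import Data.Fin as Fin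
open import Data.Fin.Properties using (pigeonhole)
open import Data.List using
  (List; []; _∷_; _∷ʳ_; _++_; _ʳ++_; length; map; null; lookup; upTo; concat; cartesianProduct; deduplicate)
open import Data.List.Membership.DecPropositional _≟w_ using (_∈?_)
open import Data.List.Membership.Propositional using (_∈_; _∉_)
open import Data.List.Membership.Propositional.Properties
open import Data.List.Properties
open import Data.List.Relation.Unary.All as All using (All)
import Data.List.Relation.Unary.AllPairs as AllPairs
open import Data.List.Relation.Unary.Any using (here; there; index)
open import Data.List.Relation.Unary.Any.Properties using (lookup-index; reverseAcc⁺)
open import Data.List.Relation.Unary.Unique.Propositional using (Unique)
import Data.List.Relation.Unary.Unique.Propositional.Properties as Unique
open import Data.Nat
open import Data.Nat.DivMod using
  ([m+kn]%n≡m%n; +-distrib-/-∣ʳ; m*n/n≡m; m%n<n; m<n*o⇒m/o<n; m<n⇒m%n≡m; m<n⇒m/n≡0; m≡m%n+[m/n]*n)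
open import Data.Nat.Divisibility using (n∣m*n)
open import Data.Nat.Properties
open import Data.Nat.Tactic.RingSolver using (solve)
open import Data.Product using (∃; ∃₂; _×_; _,_; proj₁; proj₂)
open import Data.Sum using (_⊎_; inj₁; inj₂)
open import Data.Unit using (tt)
open import Function using (_∘_)
open import Relation.Binary.Definitions using (tri<; tri≈; tri>)
open import Relation.Binary.PropositionalEquality
open import Relation.Nullary using (¬_; Dec; yes; no; does)
open import Relation.Nullary.Decidable using (True; False; toWitness; toWitnessFalse; dec-true; _⊎-dec_)

-- Counting

-- An inequality `a ≤ b` between polynomials becomes an identity for the ring solver: `l ≤ r`
-- collects the known inequalities it rests on, and `k` is the remaining slack.
linear : ∀ {a b l r} k → l ≤ r → a + r + k ≡ b + l → a ≤ b
linear {a} {b} {l} {r} k l≤r eq = +-cancelʳ-≤ r a b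
  (≤-trans (m≤m+n (a + r) k) (≤-trans (≤-reflexive eq) (+-monoʳ-≤ b l≤r)))

module _ {A B : Set} (R : A → B → Set) where

  -- A relation in place of a function lets `R x y` carry the blocks behind an assignment, which the
  -- injectivity argument then compares.
  pigeonhole-list : ∀ {xs ys} → Unique xs →
    (∀ {x} → x ∈ xs → ∃ λ y → y ∈ ys × R x y) →
    (∀ {x x′ y} → R x y → R x′ y → x ≡ x′) →
    length xs ≤ length ys
  pigeonhole-list {xs} {ys} uniq tot inj with length xs ≤? length ys
  ... | yes le = le
  ... | no nle = ⊥-elim (lookup-distinct uniq i<j same)
    where
    image : (i : Fin.Fin (length xs)) → ∃ λ y → y ∈ ys × R (lookup xs i) y
    image i = tot (∈-lookup i)

    hit : Fin.Fin (length xs) → Fin.Fin (length ys)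
    hit i = index (proj₁ (proj₂ (image i)))

    collision = pigeonhole (≰⇒> nle) hit
    i = proj₁ collision
    j = proj₁ (proj₂ collision)
    i<j = proj₁ (proj₂ (proj₂ collision))

    value : ∀ k → R (lookup xs k) (lookup ys (hit k))
    value k = subst (R (lookup xs k)) (lookup-index (proj₁ (proj₂ (image k)))) (proj₂ (proj₂ (image k)))

    same : lookup xs i ≡ lookup xs j
    same = inj (value i) (subst (R (lookup xs j) ∘ lookup ys) (sym (proj₂ (proj₂ (proj₂ collision)))) (value j))

    lookup-distinct : ∀ {zs : List A} {i j : Fin.Fin (length zs)} → Unique zs → i Fin.< j → lookup zs i ≢ lookup zs j
    lookup-distinct {_ ∷ _} {Fin.zero} {Fin.suc j} (z∉ AllPairs.∷ _) _ = All.lookup z∉ (∈-lookup j)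
    lookup-distinct {_ ∷ _} {Fin.suc i} {Fin.suc j} (_ AllPairs.∷ u) (s≤s i<j) = lookup-distinct u i<j

length-cartesianProduct : ∀ {A B : Set} (xs : List A) (ys : List B) →
  length (cartesianProduct xs ys) ≡ length xs * length ys
length-cartesianProduct [] ys = refl
length-cartesianProduct (x ∷ xs) ys =
  trans (length-++ (map (x ,_) ys)) (cong₂ _+_ (length-map (x ,_) ys) (length-cartesianProduct xs ys))

-- Block boundaries as a set of positions

module Boundaries (Bd : ℕ → Set) where

  -- The endpoint `a + n` is included, so that a block starting at `a` is still unfinished after `n`
  -- letters; the field `inside` of `Block` leaves its endpoint out.
  Free : ℕ → ℕ → Set
  Free a n = ∀ {i} → 1 ≤ i → i ≤ n → ¬ Bd (a + i)

  record Block (a n : ℕ) : Set where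
    field
      start    : Bd a
      nonempty : 1 ≤ n
      inside   : ∀ {i} → 1 ≤ i → i < n → ¬ Bd (a + i)
      end      : Bd (a + n)

  open Block public

  free-++ : ∀ {a m n} → Free a m → Free (a + m) n → Free a (m + n)
  free-++ {a} {m} {n} f g {i} 1≤i i≤m+n bd with i ≤? m
  ... | yes i≤m = f 1≤i i≤m bd
  ... | no i≰m = g (m<n⇒0<n∸m (≰⇒> i≰m)) (m≤n+o⇒m∸n≤o i m i≤m+n)
    (subst Bd (trans (cong (a +_) (sym (m+[n∸m]≡n (<⇒≤ (≰⇒> i≰m))))) (sym (+-assoc a m (i ∸ m)))) bd)

  free-< : ∀ {a n i} → Free a n → 1 ≤ i → Bd (a + i) → n < i
  free-< {n = n} {i} f 1≤i bd with i ≤? n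
  ... | yes i≤n = ⊥-elim (f 1≤i i≤n bd)
  ... | no i≰n = ≰⇒> i≰n

  block-length : ∀ {a m n} → Block a m → Block a n → m ≡ n
  block-length {a} {m} {n} b c with <-cmp m n
  ... | tri< m<n _ _ = ⊥-elim (inside c (nonempty b) m<n (end b))
  ... | tri≈ _ m≡n _ = m≡n
  ... | tri> _ _ n<m = ⊥-elim (inside b (nonempty c) n<m (end c))

  -- If the starts differed, the later one would be a boundary strictly inside the other block.
  block-start : ∀ {a b m n c} → Block a m → Block b n → a ≤ c → c < a + m → b ≤ c → c < b + n → a ≡ b
  block-start {a} {b} {m} {n} {c} p q a≤c c<a b≤c c<b with <-cmp a b
  ... | tri≈ _ a≡b _ = a≡b
  ... | tri< a<b _ _ = ⊥-elim (inside p (m<n⇒0<n∸m a<b)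
          (+-cancelˡ-< a _ _ (subst (_< a + m) (sym (m+[n∸m]≡n (<⇒≤ a<b))) (≤-<-trans b≤c c<a)))
          (subst Bd (sym (m+[n∸m]≡n (<⇒≤ a<b))) (start q)))
  ... | tri> _ _ b<a = ⊥-elim (inside q (m<n⇒0<n∸m b<a)
          (+-cancelˡ-< b _ _ (subst (_< b + n) (sym (m+[n∸m]≡n (<⇒≤ b<a))) (≤-<-trans a≤c c<b)))
          (subst Bd (sym (m+[n∸m]≡n (<⇒≤ b<a))) (start p)))

  module Search (Bd? : ∀ g → Dec (Bd g)) (Bd₀ : Bd 0) where

    search : ∀ a n → (∃ λ i → 1 ≤ i × i ≤ n × Bd (a + i)) ⊎ Free a n
    search a zero = inj₂ λ 1≤i i≤0 → ⊥-elim (<-irrefl refl (≤-trans 1≤i i≤0))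
    search a (suc n) with search a n | Bd? (a + suc n)
    ... | inj₁ (i , 1≤i , i≤n , bd) | _ = inj₁ (i , 1≤i , m≤n⇒m≤1+n i≤n , bd)
    ... | inj₂ f | yes bd = inj₁ (suc n , s≤s z≤n , ≤-refl , bd)
    ... | inj₂ f | no ¬bd = inj₂ free′
      where
      free′ : Free a (suc n)
      free′ {i} 1≤i i≤1+n bd with m≤n⇒m<n∨m≡n i≤1+n
      ... | inj₁ i<1+n = f 1≤i (s≤s⁻¹ i<1+n) bd
      ... | inj₂ refl = ¬bd bd

    last : ∀ g → ∃₂ λ a d → a + d ≡ g × Bd a × Free a d
    last zero = 0 , 0 , refl , Bd₀ , λ 1≤i i≤0 → ⊥-elim (<-irrefl refl (≤-trans 1≤i i≤0))
    last (suc g) with Bd? (suc g) | last g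
    ... | yes bd | _ = suc g , 0 , +-identityʳ _ , bd , λ 1≤i i≤0 → ⊥-elim (<-irrefl refl (≤-trans 1≤i i≤0))
    ... | no ¬bd | a , d , refl , bd , f = a , suc d , +-suc a d , bd , free′
      where
      free′ : Free a (suc d)
      free′ {i} 1≤i i≤1+d bd′ with m≤n⇒m<n∨m≡n i≤1+d
      ... | inj₁ i<1+d = f 1≤i (s≤s⁻¹ i<1+d) bd′
      ... | inj₂ refl = ¬bd (subst Bd (+-suc a d) bd′)

    last≥ : ∀ {a d c} → Free a d → Bd c → c ≤ a + d → c ≤ a
    last≥ {a} {d} {c} f bd c≤ with c ≤? a
    ... | yes c≤a = c≤a
    ... | no c≰a = ⊥-elim (f (m<n⇒0<n∸m (≰⇒> c≰a)) (m≤n+o⇒m∸n≤o c a c≤)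
                     (subst Bd (sym (m+[n∸m]≡n (<⇒≤ (≰⇒> c≰a)))) bd))

    block-ending : ∀ {c g} → Bd c → c < g → Bd g → ∃₂ λ a n → a + n ≡ g × c ≤ a × Block a n
    block-ending {c} {suc g} bdc (s≤s c≤g) bdg with last g
    ... | a , d , refl , bda , f = a , suc d , +-suc a d , last≥ f bdc c≤g , record
      { start = bda
      ; nonempty = s≤s z≤n
      ; inside = λ 1≤i i<1+d → f 1≤i (s≤s⁻¹ i<1+d)
      ; end = subst Bd (sym (+-suc a d)) bdg
      }

-- Bd is the set of block boundaries of a parse, S j (for j < R²) the position at which line j starts, and n₁ a lower
-- bound for the lengths of the lines.
module Counting
  (Bd : ℕ → Set) (Bd? : ∀ g → Dec (Bd g)) (Bd₀ : Bd 0)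
  (S : ℕ → ℕ) (R B n₁ : ℕ) (1≤B : 1 ≤ B) (1≤R : 1 ≤ R)
  (¬BdS : ∀ {j} → j < R * R → ¬ Bd (S j))
  (chain : ∀ {j p l} → j < R * R → 1 ≤ p → B ≤ l → p + l ≤ n₁ → Bd (S j + p) →
    Boundaries.Free Bd (S j + p) l → ∃ λ j′ → j′ < R * R × Boundaries.Block Bd (S j′ + p) l)
  (crossing : ∀ {j a d i} → j < R * R → 1 ≤ d → a + d ≡ S j → B ≤ i → i ≤ n₁ → Bd a →
    Boundaries.Free Bd a (d + i) →
    ∃ λ j′ → j′ < R * R × ∃ λ a′ → a′ + d ≡ S j′ × Boundaries.Block Bd a′ (d + i))
  (same-line : ∀ {j j′ p l} → j < R * R → j′ < R * R → p + l ≤ n₁ →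
    Boundaries.Block Bd (S j + p) l → Boundaries.Block Bd (S j′ + p) l → j ≡ j′)
  where

  open Boundaries Bd
  open Search Bd? Bd₀

  -- `K` bounds block lengths crudely, at the cost of one line per length; `L`, of order `B + √n₂`,
  -- is the refined bound for blocks starting beyond offset `K`.
  n₂ K L : ℕ
  n₂ = R * R
  K = B + n₂
  L = B + (B + R + R)

  private
    no-overflow : ∀ (P : ℕ → ℕ → Set) →
      (∀ {i} → i ≤ n₂ → ∃ λ j → j < n₂ × P i j) →
      (∀ {i i′ j} → P i j → P i′ j → i ≡ i′) → ⊥
    no-overflow P tot inj = <-irrefl refl (subst₂ _≤_ (length-upTo (suc n₂)) (length-upTo n₂)
      (pigeonhole-list P (Unique.upTo⁺ (suc n₂)) total inj))
      where
      total : ∀ {i} → i ∈ upTo (suc n₂) → ∃ λ j → j ∈ upTo n₂ × P i j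
      total i∈ with tot (s≤s⁻¹ (∈-upTo⁻ i∈))
      ... | j , j<n₂ , pij = j , ∈-upTo⁺ j<n₂ , pij

  -- A long crossing block z X[0..s) needs all z X[0..i) with B ≤ i < s as earlier blocks, each at a line start of its own.
  first-boundary : ∀ {j} → j < n₂ → K ≤ n₁ → ∃ λ s → 1 ≤ s × s ≤ K × Bd (S j + s)
  first-boundary {j} j<n₂ K≤n₁ with search (S j) K | last (S j)
  ... | inj₁ found | _ = found
  ... | inj₂ free | a , zero , eq , bda , _ = ⊥-elim (¬BdS j<n₂ (subst Bd (trans (sym (+-identityʳ a)) eq) bda))
  ... | inj₂ free | a , suc d , eq , bda , f = ⊥-elim (no-overflow P total injective)
    where
    P : ℕ → ℕ → Set
    P i j′ = ∃ λ a′ → a′ + suc d ≡ S j′ × Block a′ (suc d + (B + i))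

    free′ : Free a (suc d + K)
    free′ = free-++ f (subst (λ g → Free g K) (sym eq) free)

    total : ∀ {i} → i ≤ n₂ → ∃ λ j′ → j′ < n₂ × P i j′
    total {i} i≤n₂ = crossing j<n₂ (s≤s z≤n) eq (m≤m+n B i) (≤-trans B+i≤K K≤n₁) bda
      (λ 1≤k k≤ → free′ 1≤k (≤-trans k≤ (+-monoʳ-≤ (suc d) B+i≤K)))
      where
      B+i≤K : B + i ≤ K
      B+i≤K = +-monoʳ-≤ B i≤n₂

    injective : ∀ {i i′ j′} → P i j′ → P i′ j′ → i ≡ i′
    injective {i} {i′} (a₁ , e₁ , b₁) (a₂ , e₂ , b₂) with +-cancelʳ-≡ (suc d) a₁ a₂ (trans e₁ (sym e₂))
    ... | refl = +-cancelˡ-≡ B _ _ (+-cancelˡ-≡ (suc d) _ _ (block-length b₁ b₂))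

  -- If no boundary came, each of the `n₂ + 1` prefixes of length `B + i`, `i ≤ n₂`, would be a
  -- block at offset `p` of some line; but a line has only one block there.
  next-boundary : ∀ {j p} → j < n₂ → 1 ≤ p → p + K ≤ n₁ → Bd (S j + p) →
    ∃ λ i → 1 ≤ i × i ≤ K × Bd (S j + p + i)
  next-boundary {j} {p} j<n₂ 1≤p p+K≤n₁ bd with search (S j + p) K
  ... | inj₁ found = found
  ... | inj₂ free = ⊥-elim (no-overflow (λ i j′ → Block (S j′ + p) (B + i)) total
          (λ b c → +-cancelˡ-≡ B _ _ (block-length b c)))
    where
    total : ∀ {i} → i ≤ n₂ → ∃ λ j′ → j′ < n₂ × Block (S j′ + p) (B + i)
    total {i} i≤n₂ = chain j<n₂ 1≤p (m≤m+n B i) (≤-trans (+-monoʳ-≤ p (+-monoʳ-≤ B i≤n₂)) p+K≤n₁) bd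
      (λ 1≤k k≤ → free 1≤k (≤-trans k≤ (+-monoʳ-≤ B i≤n₂)))

  -- A block of length > L at p needs B + 2R + 1 earlier lines with a block at p, hence as many blocks [q, p) with
  -- distinct q.  At least R + 1 of these q lie at distance ≥ B + R from p; their prefixes [q, p - 1 - d), d < R, are
  -- (R + 1) R blocks covering the position p - R - 1, no two of them in the same line: impossible, as n₂ = R².
  -- The excess over n₂ is detected by the slots inj₂, which absorb the q at distance < B + R.
  short-block : ∀ {j p} → j < n₂ → K < p → p + L ≤ n₁ → Bd (S j + p) →
    ∃ λ i → 1 ≤ i × i ≤ L × Bd (S j + p + i)
  short-block {j} {p} j<n₂ K<p p+L≤n₁ bd with search (S j + p) L
  ... | inj₁ found = found
  ... | inj₂ free = ⊥-elim (too-many (subst₂ _≤_ size₁ size₂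
          (pigeonhole-list Slot (Unique.cartesianProduct⁺ (Unique.upTo⁺ (suc T)) (Unique.upTo⁺ R)) total injective)))
    where
    T : ℕ
    T = B + R + R

    p≤n₁ : p ≤ n₁
    p≤n₁ = ≤-trans (m≤m+n p L) p+L≤n₁

    K≤n₁ : K ≤ n₁
    K≤n₁ = ≤-trans (<⇒≤ K<p) p≤n₁

    -- A line in which the prefix of length `B + i` of the long block is itself a block at `p`,
    -- together with the block `[q, p)` of length `l` just before it.
    record Visit (i l : ℕ) : Set where
      field
        {line} {q} : ℕ
        line<n₂ : line < n₂
        i≤T : i ≤ T
        1≤q : 1 ≤ q
        q+l≡p : q + l ≡ p
        into : Block (S line + q) l
        out : Block (S line + p) (B + i)
    open Visit

    -- The first boundary of the line has offset at most `K < p`, so the block ending at `p` starts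
    -- inside the line and `1 ≤ q`.
    visit : ∀ {i} → i ≤ T → ∃ λ l → Visit i l
    visit {i} i≤T with chain j<n₂ (≤-trans (s≤s z≤n) K<p) (m≤m+n B i)
                         (≤-trans (+-monoʳ-≤ p (+-monoʳ-≤ B i≤T)) p+L≤n₁) bd
                         (λ 1≤k k≤ → free 1≤k (≤-trans k≤ (+-monoʳ-≤ B i≤T)))
    ... | j′ , j′<n₂ , out with first-boundary j′<n₂ K≤n₁
    ... | s , 1≤s , s≤K , bds with block-ending bds (+-monoʳ-< (S j′) (≤-<-trans s≤K K<p)) (start out)
    ... | a , l , a+l≡ , s≤a , into with m≤n⇒∃[o]m+o≡n s≤a
    ... | o , refl = l , record
      { line<n₂ = j′<n₂ ; i≤T = i≤T ; 1≤q = ≤-trans 1≤s (m≤m+n s o)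
      ; q+l≡p = +-cancelˡ-≡ (S j′) _ _ (trans (sym (+-assoc (S j′) (s + o) l))
          (trans (cong (_+ l) (sym (+-assoc (S j′) s o))) a+l≡))
      ; into = subst (λ g → Block g l) (+-assoc (S j′) s o) into
      ; out = out }

    -- The length `l` fixes `q = p - l`, hence the word of the block `[q, p)`. Equal words are the
    -- same block, so the lines agree, and the block at `p` in that line has only one length.
    visit-index : ∀ {i i′ l} → Visit i l → Visit i′ l → i ≡ i′
    visit-index {l = l} v w = +-cancelˡ-≡ B _ _ (block-length (out v)
        (subst (λ k → Block (S k + p) _) (sym line≡) (out w)))
      where
      q≡ : q v ≡ q w
      q≡ = +-cancelʳ-≡ l _ _ (trans (q+l≡p v) (sym (q+l≡p w)))
      line≡ : line v ≡ line w
      line≡ = same-line (line<n₂ v) (line<n₂ w) (≤-trans (≤-reflexive (q+l≡p v)) p≤n₁) (into v)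
        (subst (λ k → Block (S (line w) + k) l) (sym q≡) (into w))

    -- If `l` is at least `B + R`, the pair is sent to the line in which `[q, p - 1 - d)` is a
    -- block, of length `m`; otherwise to `(l, d)`, which determines it by `visit-index`.
    Slot : ℕ × ℕ → ℕ ⊎ ℕ × ℕ → Set
    Slot (i , d) (inj₁ j′) = ∃₂ λ l m → ∃ λ (v : Visit i l) →
      B + R ≤ l × d < R × m + suc d ≡ l × Block (S j′ + q v) m
    Slot (i , d) (inj₂ (l , d′)) = Visit i l × d ≡ d′

    slots : List (ℕ ⊎ ℕ × ℕ)
    slots = map inj₁ (upTo n₂) ++ map inj₂ (cartesianProduct (upTo (B + R)) (upTo R))

    total : ∀ {x} → x ∈ cartesianProduct (upTo (suc T)) (upTo R) → ∃ λ y → y ∈ slots × Slot x y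
    total {i , d} x∈ with ∈-cartesianProduct⁻ (upTo (suc T)) (upTo R) x∈
    ... | i∈ , d∈ with visit (s≤s⁻¹ (∈-upTo⁻ i∈))
    ... | l , v with l <? B + R
    ... | yes l< = inj₂ (l , d) ,
            ∈-++⁺ʳ (map inj₁ (upTo n₂)) (∈-map⁺ inj₂ (∈-cartesianProduct⁺ (∈-upTo⁺ l<) d∈)) , v , refl
    ... | no l≮ with chain {line v} {q v} {l ∸ suc d} (line<n₂ v) (1≤q v) B≤ q+≤ (start (into v))
                       (λ 1≤k k≤ → inside (into v) 1≤k (≤-<-trans k≤ l-1-d<l))
      where
      d<l : suc d ≤ l
      d<l = ≤-trans (∈-upTo⁻ d∈) (≤-trans (m≤n+m R B) (≮⇒≥ l≮))
      l-1-d<l : l ∸ suc d < l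
      l-1-d<l = ∸-monoʳ-< {l} {suc d} {0} (s≤s z≤n) d<l
      B≤ : B ≤ l ∸ suc d
      B≤ = m+n≤o⇒m≤o∸n B (≤-trans (+-monoʳ-≤ B (∈-upTo⁻ d∈)) (≮⇒≥ l≮))
      q+≤ : q v + (l ∸ suc d) ≤ n₁
      q+≤ = ≤-trans (+-monoʳ-≤ (q v) (m∸n≤m l (suc d))) (≤-trans (≤-reflexive (q+l≡p v)) p≤n₁)
    ... | j″ , j″<n₂ , b = inj₁ j″ , ∈-++⁺ˡ (∈-map⁺ inj₁ (∈-upTo⁺ j″<n₂)) ,
            l , l ∸ suc d , v , ≮⇒≥ l≮ , ∈-upTo⁻ d∈ ,
            m∸n+n≡m (≤-trans (∈-upTo⁻ d∈) (≤-trans (m≤n+m R B) (≮⇒≥ l≮))) , b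

    covers : ∀ {q l} → q + l ≡ p → B + R ≤ l → q ≤ p ∸ suc R
    covers {q} {l} refl B+R≤l = m+n≤o⇒m≤o∸n q (+-monoʳ-≤ q (≤-trans (+-monoˡ-≤ R 1≤B) B+R≤l))

    covers′ : ∀ {q l m d} → q + l ≡ p → B + R ≤ l → d < R → m + suc d ≡ l → p ∸ suc R < q + m
    covers′ {q} {_} {m} {d} refl B+R≤l d<R refl =
      linear 0 (≤-trans (+-monoʳ-≤ (suc (q + (m + suc d) ∸ suc R)) d<R)
        (≤-reflexive (trans (sym (+-suc _ R)) (m∸n+n≡m 1+R≤)))) (eq (q + (m + suc d) ∸ suc R))
      where
      1+R≤ : suc R ≤ q + (m + suc d)
      1+R≤ = ≤-trans (≤-trans (+-monoˡ-≤ R 1≤B) B+R≤l) (m≤n+m _ q)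
      eq : ∀ y → suc y + (q + (m + suc d)) + 0 ≡ q + m + (suc y + suc d)
      eq y = solve (y ∷ q ∷ m ∷ d ∷ [])

    below : ∀ {i l m d k} (v : Visit i l) → B + R ≤ l → d < R → m + suc d ≡ l → S k + (p ∸ suc R) < S k + q v + m
    below {m = m} {k = k} v far d<R eq =
      subst (S k + (p ∸ suc R) <_) (sym (+-assoc (S k) (q v) m)) (+-monoʳ-< (S k) (covers′ (q+l≡p v) far d<R eq))

    injective : ∀ {x x′ y} → Slot x y → Slot x′ y → x ≡ x′
    injective {y = inj₂ (l , d)} (v , refl) (w , refl) = cong (_, d) (visit-index v w)
    injective {x = i , d} {x′ = i′ , d′} {y = inj₁ j′}
      (l , m , v , far , d<R , m+d≡l , b) (l′ , m′ , v′ , far′ , d′<R , m′+d′≡l′ , b′)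
      -- Both blocks cover position `p - R - 1` of line `j′`, hence coincide; `q` then gives `l`,
      -- and `l` with the block length gives `d`.
      with +-cancelˡ-≡ (S j′) (q v) (q v′) (block-start b b′
             (+-monoʳ-≤ (S j′) (covers (q+l≡p v) far)) (below v far d<R m+d≡l)
             (+-monoʳ-≤ (S j′) (covers (q+l≡p v′) far′)) (below v′ far′ d′<R m′+d′≡l′))
    ... | q≡ with +-cancelˡ-≡ (q v) l l′ (trans (q+l≡p v) (sym (trans (cong (_+ l′) q≡) (q+l≡p v′))))
    ... | refl with block-length b (subst (λ k → Block (S j′ + k) m′) (sym q≡) b′)
    ... | refl = cong₂ _,_ (visit-index v v′) (suc-injective (+-cancelˡ-≡ m _ _ (trans m+d≡l (sym m′+d′≡l′))))

    size₁ : length (cartesianProduct (upTo (suc T)) (upTo R)) ≡ suc T * R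
    size₁ = trans (length-cartesianProduct (upTo (suc T)) (upTo R)) (cong₂ _*_ (length-upTo (suc T)) (length-upTo R))

    size₂ : length slots ≡ n₂ + (B + R) * R
    size₂ = trans (length-++ (map inj₁ (upTo n₂))) (cong₂ _+_
      (trans (length-map inj₁ (upTo n₂)) (length-upTo n₂))
      (trans (length-map inj₂ (cartesianProduct (upTo (B + R)) (upTo R)))
        (trans (length-cartesianProduct (upTo (B + R)) (upTo R)) (cong₂ _*_ (length-upTo (B + R)) (length-upTo R)))))

    -- The pairs outnumber the slots by exactly `R`.
    too-many : suc T * R ≤ n₂ + (B + R) * R → ⊥
    too-many le = <-irrefl refl (≤-trans 1≤R (linear 0 le eq))
      where
      eq : R + (R * R + (B + R) * R) + 0 ≡ 0 + suc (B + R + R) * R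
      eq = solve (R ∷ B ∷ [])

  -- Let `q` be the last boundary of the line up to `p`. Beyond `K`, `short-block` bounds the block
  -- at `q` by `L`; for `q ≤ K` the next boundary would come by `2K ≤ p`, against the choice of `q`.
  boundary-in-window : ∀ {j p} → j < n₂ → K + K ≤ p → p + L ≤ n₁ → p + K ≤ n₁ →
    ∃ λ b → p < b × b ≤ p + L × Bd (S j + b)
  boundary-in-window {j} {p} j<n₂ 2K≤p p+L≤n₁ p+K≤n₁
    with first-boundary j<n₂ (≤-trans (m≤n+m K p) p+K≤n₁) | last (S j + p)
  ... | s , 1≤s , s≤K , bds | a , d , a+d≡ , bda , free
    with m≤n⇒∃[o]m+o≡n (last≥ free bds (≤-trans
           (+-monoʳ-≤ (S j) (≤-trans s≤K (≤-trans (m≤m+n K K) 2K≤p))) (≤-reflexive (sym a+d≡))))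
  ... | o , refl = result (s + o) (≤-trans 1≤s (m≤m+n s o)) (+-assoc (S j) s o)
    where
    result : ∀ q → 1 ≤ q → S j + s + o ≡ S j + q → ∃ λ b → p < b × b ≤ p + L × Bd (S j + b)
    result q 1≤q eq = choose (K <? q)
      where
      q+d≡p : q + d ≡ p
      q+d≡p = +-cancelˡ-≡ (S j) _ _ (trans (sym (+-assoc (S j) q d)) (trans (cong (_+ d) (sym eq)) a+d≡))
      q≤p : q ≤ p
      q≤p = ≤-trans (m≤m+n q d) (≤-reflexive q+d≡p)
      bdq : Bd (S j + q)
      bdq = subst Bd eq bda
      beyond : ∀ {i} → 1 ≤ i → Bd (S j + q + i) → p < q + i
      beyond {i} 1≤i bd = subst (_< q + i) q+d≡p (+-monoʳ-< q (free-< free 1≤i (subst (λ g → Bd (g + i)) (sym eq) bd)))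
      choose : Dec (K < q) → ∃ λ b → p < b × b ≤ p + L × Bd (S j + b)
      choose (yes K<q) with short-block j<n₂ K<q (≤-trans (+-monoˡ-≤ L q≤p) p+L≤n₁) bdq
      ... | i , 1≤i , i≤L , bd = q + i , beyond 1≤i bd , +-mono-≤ q≤p i≤L , subst Bd (+-assoc (S j) q i) bd
      choose (no K≮q) with next-boundary j<n₂ 1≤q (≤-trans (+-monoˡ-≤ K q≤p) p+K≤n₁) bdq
      ... | i , 1≤i , i≤K , bd = ⊥-elim (<-irrefl refl
              (≤-trans (beyond 1≤i bd) (≤-trans (+-mono-≤ (≮⇒≥ K≮q) i≤K) 2K≤p)))

-- Words and LZ78 dictionaries

∷ʳ≢[] : ∀ {v : Word} {c} → v ∷ʳ c ≢ []
∷ʳ≢[] {[]} ()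
∷ʳ≢[] {_ ∷ _} ()

-- Letters are appended on the right, as the parser does with its unfinished block.
seg : (ℕ → Bool) → ℕ → ℕ → Word
seg f a zero    = []
seg f a (suc n) = seg f a n ∷ʳ f (a + n)

module _ {f : ℕ → Bool} where

  length-seg : ∀ a n → length (seg f a n) ≡ n
  length-seg a zero = refl
  length-seg a (suc n) = trans (length-++ (seg f a n)) (trans (+-comm _ 1) (cong suc (length-seg a n)))

  seg-++ : ∀ a m n → seg f a (m + n) ≡ seg f a m ++ seg f (a + m) n
  seg-++ a m zero rewrite +-identityʳ m = sym (++-identityʳ _)
  seg-++ a m (suc n) rewrite +-suc m n = trans
    (cong₂ _∷ʳ_ (seg-++ a m n) (cong f (sym (+-assoc a m n))))
    (++-assoc (seg f a m) (seg f (a + m) n) _)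

  seg-cong : ∀ {g a b} n → (∀ {r} → r < n → f (a + r) ≡ g (b + r)) → seg f a n ≡ seg g b n
  seg-cong zero h = refl
  seg-cong (suc n) h = cong₂ _∷ʳ_ (seg-cong n (λ r<n → h (m<n⇒m<1+n r<n))) (h ≤-refl)

  seg-letters : ∀ {g a b} n → seg f a n ≡ seg g b n → ∀ {r} → r < n → f (a + r) ≡ g (b + r)
  seg-letters {g} {a} {b} (suc n) eq {r} r<1+n with ∷ʳ-injective (seg f a n) (seg g b n) eq | m≤n⇒m<n∨m≡n (s≤s⁻¹ r<1+n)
  ... | eq′ , _ | inj₁ r<n = seg-letters n eq′ r<n
  ... | _ , eq″ | inj₂ refl = eq″

  seg-length-injective : ∀ {g a b} m n → seg f a m ≡ seg g b n → m ≡ n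
  seg-length-injective {g} {a} {b} m n eq = trans (sym (length-seg a m)) (trans (cong length eq) (length-seg′ b n))
    where
    length-seg′ : ∀ a n → length (seg g a n) ≡ n
    length-seg′ a zero = refl
    length-seg′ a (suc n) = trans (length-++ (seg g a n)) (trans (+-comm _ 1) (cong suc (length-seg′ a n)))

-- Most recent block first.
data Dictionary : List Word → Set where
  empty : Dictionary []
  snoc  : ∀ {D v c} → Dictionary D → v ≡ [] ⊎ v ∈ D → v ∷ʳ c ∉ D → Dictionary ((v ∷ʳ c) ∷ D)

prefix-∷ʳ : ∀ p {s} v {c : Bool} → p ++ s ≡ v ∷ʳ c → p ≡ v ∷ʳ c ⊎ p IsPrefixOf v
prefix-∷ʳ [] v eq = inj₂ (v , refl)
prefix-∷ʳ (a ∷ []) [] eq = inj₁ (cong (_∷ []) (∷-injectiveˡ eq))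
prefix-∷ʳ (a ∷ _ ∷ _) [] eq with ∷-injectiveʳ eq
... | ()
prefix-∷ʳ (a ∷ p) (b ∷ v) eq with ∷-injective eq
... | refl , eq′ with prefix-∷ʳ p v eq′
... | inj₁ refl = inj₁ refl
... | inj₂ (s , refl) = inj₂ (s , refl)

prefix-closed : ∀ {D u p} → Dictionary D → u ∈ D → p ≢ [] → p IsPrefixOf u → p ∈ D
prefix-closed (snoc d _ _) (there u∈D) p≢[] pu = there (prefix-closed d u∈D p≢[] pu)
prefix-closed {p = p} (snoc {v = v} d v∈ _) (here refl) p≢[] (s , eq) with prefix-∷ʳ p v eq | v∈
... | inj₁ refl | _ = here refl
... | inj₂ (s′ , eq′) | inj₁ refl = ⊥-elim (p≢[] (++-conicalˡ p s′ eq′))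
... | inj₂ pv | inj₂ v∈D = there (prefix-closed d v∈D p≢[] pv)

-- Unwinds the dictionary into reading order, checking each block against the older ones only.
dictionary-parse : ∀ {D} rest → Dictionary D → LZParse D rest → LZParse [] (D ʳ++ rest)
dictionary-parse rest empty lz = lz
dictionary-parse rest d@(snoc {v = v} d′ _ new) lz = dictionary-parse _ d′
  (∷ʳ≢[] {v} , (λ p → prefix-closed d (here refl)) , (λ _ → new) , lz)

flatten : List Word → Word
flatten []      = []
flatten (u ∷ D) = flatten D ++ u

concat-ʳ++ : ∀ D rest → concat (D ʳ++ rest) ≡ flatten D ++ concat rest
concat-ʳ++ [] rest = refl
concat-ʳ++ (u ∷ D) rest = trans (concat-ʳ++ D (u ∷ rest)) (sym (++-assoc (flatten D) u (concat rest)))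

parse-complete : ∀ {D} → Dictionary D → IsLZ78Parsing (flatten D) (D ʳ++ [])
parse-complete {D} d = trans (concat-ʳ++ D []) (++-identityʳ _) , dictionary-parse [] d tt

-- An unfinished block is a dictionary word, and the last block of a parsing is the only one allowed
-- to repeat an earlier one.
parse-partial : ∀ {D v} → Dictionary D → v ∈ D → v ≢ [] → IsLZ78Parsing (flatten D ++ v) (D ʳ++ (v ∷ []))
parse-partial {D} {v} d v∈D v≢[] =
  trans (concat-ʳ++ D (v ∷ [])) (cong (flatten D ++_) (++-identityʳ v)) ,
  dictionary-parse (v ∷ []) d (v≢[] , (λ p p≢[] pv → there (prefix-closed d v∈D p≢[] pv)) , (λ h → ⊥-elim (h refl)) , tt)

-- D g and π g are the dictionary and the unfinished block after g letters of t.
module Parsing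
  (t : ℕ → Bool) (D : ℕ → List Word) (π : ℕ → Word) (π₀ : π 0 ≡ [])
  (absorb : ∀ g → (π (suc g) ≡ [] × π g ∷ʳ t g ∉ D g × D (suc g) ≡ (π g ∷ʳ t g) ∷ D g)
                ⊎ (π (suc g) ≡ π g ∷ʳ t g × π g ∷ʳ t g ∈ D g × D (suc g) ≡ D g))
  where

  Bd : ℕ → Set
  Bd g = π g ≡ []

  Bd? : ∀ g → Dec (Bd g)
  Bd? g with π g
  ... | []    = yes refl
  ... | _ ∷ _ = no λ ()

  open Boundaries Bd
  open Search Bd? π₀

  partial : ∀ {a} n → Bd a → Free a n → π (a + n) ≡ seg t a n
  partial {a} zero bd _ = trans (cong π (+-identityʳ a)) bd
  partial {a} (suc n) bd free with absorb (a + n)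
  ... | inj₁ (bd′ , _) = ⊥-elim (free (s≤s z≤n) ≤-refl (trans (cong π (+-suc a n)) bd′))
  ... | inj₂ (eq , _) = trans (cong π (+-suc a n)) (trans eq
          (cong (_∷ʳ t (a + n)) (partial n bd (λ 1≤i i≤n → free 1≤i (m≤n⇒m≤1+n i≤n)))))

  partial-∈ : ∀ g → π g ≡ [] ⊎ π g ∈ D g
  partial-∈ zero = inj₁ π₀
  partial-∈ (suc g) with absorb g
  ... | inj₁ (bd , _) = inj₁ bd
  ... | inj₂ (eq , v∈D , eqD) = inj₂ (subst₂ _∈_ (sym eq) (sym eqD) v∈D)

  D-step : ∀ {u} g → u ∈ D g → u ∈ D (suc g)
  D-step g u∈D with absorb g
  ... | inj₁ (_ , _ , eqD) = subst (_ ∈_) (sym eqD) (there u∈D)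
  ... | inj₂ (_ , _ , eqD) = subst (_ ∈_) (sym eqD) u∈D

  D-mono : ∀ {u g h} → g ≤ h → u ∈ D g → u ∈ D h
  D-mono {u} {g} g≤h u∈D with m≤n⇒∃[o]m+o≡n g≤h
  ... | o , refl = go o
    where
    go : ∀ o → u ∈ D (g + o)
    go zero = subst (λ k → u ∈ D k) (sym (+-identityʳ g)) u∈D
    go (suc o) = subst (λ k → u ∈ D k) (sym (+-suc g o)) (D-step (g + o) (go o))

  block-new : ∀ {a n} → Block a (suc n) → seg t a (suc n) ∉ D (a + n) × seg t a (suc n) ∈ D (a + suc n)
  block-new {a} {n} b with absorb (a + n) | partial n (start b) (λ 1≤i i≤n → inside b 1≤i (s≤s i≤n))
  ... | inj₁ (_ , v∉D , eqD) | π≡ rewrite π≡ =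
          v∉D , subst (λ k → seg t a (suc n) ∈ D k) (sym (+-suc a n)) (subst (_ ∈_) (sym eqD) (here refl))
  ... | inj₂ (eq , _) | _ = ⊥-elim (∷ʳ≢[] {π (a + n)} (trans (sym eq) (trans (cong π (sym (+-suc a n))) (end b))))

  block-∈ : ∀ {a n} → Block a n → seg t a n ∈ D (a + n)
  block-∈ {n = zero} b = ⊥-elim (<-irrefl refl (nonempty b))
  block-∈ {n = suc n} b = proj₂ (block-new b)

  private
    distinct-< : ∀ {a b n} → Block a n → Block b n → seg t a n ≡ seg t b n → ¬ a < b
    distinct-< {n = zero} p q eq a<b = <-irrefl refl (nonempty p)
    distinct-< {a} {b} {suc n} p q eq a<b = proj₁ (block-new q)
      (D-mono (≤-trans (≤-reflexive (+-suc a n)) (+-monoˡ-≤ n a<b)) (subst (_∈ D (a + suc n)) eq (block-∈ p)))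

  -- A block is absent from the dictionary until it is completed, so the later of two equal blocks
  -- could not have been formed.
  distinct : ∀ {a b n} → Block a n → Block b n → seg t a n ≡ seg t b n → a ≡ b
  distinct {a} {b} p q eq with <-cmp a b
  ... | tri< a<b _ _ = ⊥-elim (distinct-< p q eq a<b)
  ... | tri≈ _ a≡b _ = a≡b
  ... | tri> _ _ b<a = ⊥-elim (distinct-< q p (sym eq) b<a)

  origin : ∀ {u} g → u ∈ D g → u ∈ D 0 ⊎ ∃₂ λ a n → a + n ≤ g × Block a n × u ≡ seg t a n
  origin zero u∈D = inj₁ u∈D
  origin {u} (suc g) u∈D with absorb g
  ... | inj₂ (_ , _ , eqD) = weaken (origin g (subst (u ∈_) eqD u∈D))
    where
    weaken : (u ∈ D 0 ⊎ ∃₂ λ a n → a + n ≤ g × Block a n × u ≡ seg t a n) → _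
    weaken (inj₁ h) = inj₁ h
    weaken (inj₂ (a , n , le , b , eq)) = inj₂ (a , n , m≤n⇒m≤1+n le , b , eq)
  ... | inj₁ (bd , _ , eqD) with subst (u ∈_) eqD u∈D
  ... | there u∈D′ = weaken (origin g u∈D′)
    where
    weaken : (u ∈ D 0 ⊎ ∃₂ λ a n → a + n ≤ g × Block a n × u ≡ seg t a n) → _
    weaken (inj₁ h) = inj₁ h
    weaken (inj₂ (a , n , le , b , eq)) = inj₂ (a , n , m≤n⇒m≤1+n le , b , eq)
  ... | here refl with block-ending π₀ (s≤s z≤n) bd
  ... | a , zero , _ , _ , b = ⊥-elim (<-irrefl refl (nonempty b))
  ... | a , suc n , a+n≡ , _ , b with suc-injective (trans (sym (+-suc a n)) a+n≡)
  ... | refl = inj₂ (a , suc n , ≤-reflexive a+n≡ , b ,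
          cong (_∷ʳ t (a + n)) (partial n (start b) (λ 1≤i i≤n → inside b 1≤i (s≤s i≤n))))

  -- An unfinished block lies in the dictionary, so it was completed earlier as a block or belongs
  -- to the initial dictionary. This is the source of all the earlier blocks that are counted.
  prefix-origin : ∀ {a n} → Bd a → 1 ≤ n → Free a n →
    seg t a n ∈ D 0 ⊎ ∃ λ b → b + n ≤ a + n × Block b n × seg t b n ≡ seg t a n
  prefix-origin {a} {n} bd 1≤n free with partial-∈ (a + n) | partial n bd free
  ... | inj₁ bd′ | _ = ⊥-elim (free 1≤n ≤-refl bd′)
  ... | inj₂ π∈D | π≡ with origin (a + n) (subst (_∈ D (a + n)) π≡ π∈D)
  ... | inj₁ h = inj₁ h
  ... | inj₂ (b , m , le , blk , eq) with seg-length-injective n m eq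
  ... | refl = inj₂ (b , le , blk , sym eq)

  dictionary : Dictionary (D 0) → ∀ g → Dictionary (D g)
  dictionary d zero = d
  dictionary d (suc g) with absorb g
  ... | inj₁ (_ , v∉D , eqD) = subst Dictionary (sym eqD) (snoc (dictionary d g) (partial-∈ g) v∉D)
  ... | inj₂ (_ , _ , eqD) = subst Dictionary (sym eqD) (dictionary d g)

  text : ∀ g → flatten (D g) ++ π g ≡ flatten (D 0) ++ seg t 0 g
  text zero = cong (flatten (D 0) ++_) π₀
  text (suc g) with absorb g
  ... | inj₁ (bd , _ , eqD) = begin
          flatten (D (suc g)) ++ π (suc g)               ≡⟨ cong₂ (λ E v → flatten E ++ v) eqD bd ⟩
          (flatten (D g) ++ (π g ∷ʳ t g)) ++ []          ≡⟨ ++-identityʳ _ ⟩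
          flatten (D g) ++ (π g ∷ʳ t g)                  ≡⟨ ++-assoc (flatten (D g)) (π g) _ ⟨
          (flatten (D g) ++ π g) ∷ʳ t g                  ≡⟨ cong (_∷ʳ t g) (text g) ⟩
          (flatten (D 0) ++ seg t 0 g) ∷ʳ t g            ≡⟨ ++-assoc (flatten (D 0)) (seg t 0 g) _ ⟩
          flatten (D 0) ++ seg t 0 (suc g)               ∎
    where open ≡-Reasoning
  ... | inj₂ (eq , _ , eqD) = begin
          flatten (D (suc g)) ++ π (suc g)               ≡⟨ cong₂ (λ E v → flatten E ++ v) eqD eq ⟩
          flatten (D g) ++ (π g ∷ʳ t g)                  ≡⟨ ++-assoc (flatten (D g)) (π g) _ ⟨
          (flatten (D g) ++ π g) ∷ʳ t g                  ≡⟨ cong (_∷ʳ t g) (text g) ⟩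
          (flatten (D 0) ++ seg t 0 g) ∷ʳ t g            ≡⟨ ++-assoc (flatten (D 0)) (seg t 0 g) _ ⟩
          flatten (D 0) ++ seg t 0 (suc g)               ∎
    where open ≡-Reasoning

  parsing : Dictionary (D 0) → ∀ g →
    ∃ λ ms → IsLZ78Parsing (flatten (D 0) ++ seg t 0 g) ms × (∀ {u} → u ∈ D g → u ∈ ms)
  parsing d g = rest (Bd? g) (partial-∈ g)
    where
    included : ∀ vs {u} → u ∈ D g → u ∈ D g ʳ++ vs
    included vs u∈D = reverseAcc⁺ vs (D g) (inj₂ u∈D)
    rest : Dec (Bd g) → π g ≡ [] ⊎ π g ∈ D g →
      ∃ λ ms → IsLZ78Parsing (flatten (D 0) ++ seg t 0 g) ms × (∀ {u} → u ∈ D g → u ∈ ms)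
    rest (yes bd) _ = D g ʳ++ [] ,
      subst (λ w → IsLZ78Parsing w (D g ʳ++ []))
        (trans (sym (++-identityʳ _)) (trans (cong (flatten (D g) ++_) (sym bd)) (text g)))
        (parse-complete (dictionary d g)) ,
      included []
    rest (no ¬bd) (inj₁ bd) = ⊥-elim (¬bd bd)
    rest (no ¬bd) (inj₂ π∈D) = D g ʳ++ (π g ∷ []) ,
      subst (λ w → IsLZ78Parsing w (D g ʳ++ (π g ∷ []))) (text g) (parse-partial (dictionary d g) π∈D ¬bd) ,
      included (π g ∷ [])

-- The construction, relative to the word x

push : List Word → Word → List Word × Word
push D v with v ∈? D
... | yes _ = D , v
... | no _  = v ∷ D , []

push-spec : ∀ D v → (proj₂ (push D v) ≡ [] × v ∉ D × proj₁ (push D v) ≡ v ∷ D)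
                  ⊎ (proj₂ (push D v) ≡ v × v ∈ D × proj₁ (push D v) ≡ D)
push-spec D v with v ∈? D
... | yes v∈D = inj₂ (refl , v∈D , refl)
... | no v∉D  = inj₁ (refl , v∉D , refl)

ones : ℕ → Word
ones = seg (λ _ → true) 0

OnesUpTo : List Word → ℕ → Set
OnesUpTo D k = (∀ {i} → 1 ≤ i → i ≤ k → ones i ∈ D) × (∀ {i} → k < i → ones i ∉ D)

-- The blocks of 010111011111 and of 0010111011111: the additional 0 delays the blocks 1ⁱ by one.
preamble-blocks preamble-blocks₀ : List Word
preamble-blocks =
  (true ∷ true ∷ true ∷ []) ∷ (false ∷ true ∷ true ∷ []) ∷ (true ∷ true ∷ []) ∷
  (false ∷ true ∷ []) ∷ (true ∷ []) ∷ (false ∷ []) ∷ []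
preamble-blocks₀ =
  (true ∷ true ∷ []) ∷ (false ∷ true ∷ true ∷ true ∷ []) ∷ (true ∷ []) ∷
  (false ∷ true ∷ true ∷ []) ∷ (false ∷ true ∷ []) ∷ (false ∷ []) ∷ []

member : ∀ {u D} {_ : True (u ∈? D)} → u ∈ D
member {_} {_} {u∈D} = toWitness u∈D

extend : ∀ {D} → Dictionary D → ∀ v c {_ : True ((v ≟w []) ⊎-dec (v ∈? D))} {_ : False ((v ∷ʳ c) ∈? D)} →
  Dictionary ((v ∷ʳ c) ∷ D)
extend d v c {v∈} {new} = snoc d (toWitness v∈) (toWitnessFalse new)

two-more : ∀ a j → 2 + (a + (j + j)) ≡ a + (suc j + suc j)
two-more a j = solve (a ∷ j ∷ [])

next-triangular : ∀ i → (3 + i) * (4 + i) + 12 + 2 * (4 + i) ≡ (4 + i) * (5 + i) + 12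
next-triangular i = solve (i ∷ [])

line-cost : ∀ j n N → j * (n + (N + N) + 5) + (4 + N) + suc (n + N) ≡ suc j * (n + (N + N) + 5)
line-cost j n N = solve (j ∷ n ∷ N ∷ [])

module Construction
  (x : ℕ → Bool)
  (x₀ : x 0 ≡ false) (x₁ : x 1 ≡ true) (x₂ : x 2 ≡ true) (x₃ : x 3 ≡ false)
  (no-111 : ∀ {p} → x p ≡ true → x (1 + p) ≡ true → x (2 + p) ≡ true → ⊥)
  (h : ℕ)
  where

  n₁ : ℕ
  n₁ = 3 + h

  X : ℕ → Word
  X = seg x 0

  -- The invariant making the next line and the next gadget single blocks: `X (suc l)` and
  -- `ones (suc k)` are new, while their longest proper prefixes are known.
  record Ready (D : List Word) (l k : ℕ) : Set where
    field
      valid : Dictionary D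
      X-∈ : X l ∈ D
      X-∉ : ∀ {i} → l < i → X i ∉ D
      ones-range : OnesUpTo D k
  open Ready

  X≢ones : ∀ {l i} → X (suc l) ≢ ones i
  X≢ones {l} {i} eq with seg-length-injective (suc l) i eq
  ... | refl with trans (sym x₀) (seg-letters (suc l) eq {0} (s≤s z≤n))
  ... | ()

  ready-line : ∀ {D l k} → Ready D l k → Ready (X (suc l) ∷ D) (suc l) k
  ready-line {D} {l} {k} ρ = record
    { valid = snoc (valid ρ) (inj₂ (X-∈ ρ)) (X-∉ ρ ≤-refl)
    ; X-∈ = here refl
    ; X-∉ = X-absent
    ; ones-range = (λ 1≤i i≤k → there (proj₁ (ones-range ρ) 1≤i i≤k)) , ones-absent
    }
    where
    X-absent : ∀ {i} → suc l < i → X i ∉ X (suc l) ∷ D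
    X-absent {i} l<i (here eq) = <-irrefl (sym (seg-length-injective i (suc l) eq)) l<i
    X-absent l<i (there X∈D) = X-∉ ρ (<-trans ≤-refl l<i) X∈D
    ones-absent : ∀ {i} → k < i → ones i ∉ X (suc l) ∷ D
    ones-absent {i} k<i (here eq) = X≢ones {l} {i} (sym eq)
    ones-absent k<i (there ones∈D) = proj₂ (ones-range ρ) k<i ones∈D

  ones-snoc : ∀ {D k} → OnesUpTo D k → OnesUpTo (ones (suc k) ∷ D) (suc k)
  ones-snoc {D} {k} (∈D , ∉D) = present , absent
    where
    present : ∀ {i} → 1 ≤ i → i ≤ suc k → ones i ∈ ones (suc k) ∷ D
    present 1≤i i≤1+k with m≤n⇒m<n∨m≡n i≤1+k
    ... | inj₁ i<1+k = there (∈D 1≤i (s≤s⁻¹ i<1+k))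
    ... | inj₂ refl = here refl
    absent : ∀ {i} → suc k < i → ones i ∉ ones (suc k) ∷ D
    absent {i} k<i (here eq) = <-irrefl (sym (seg-length-injective i (suc k) eq)) k<i
    absent k<i (there h) = ∉D (<-trans ≤-refl k<i) h

  ready-ones : ∀ {D l k} → 1 ≤ k → Ready D (suc l) k → Ready (ones (suc k) ∷ D) (suc l) (suc k)
  ready-ones {D} {l} {k} 1≤k ρ = record
    { valid = snoc (valid ρ) (inj₂ (proj₁ (ones-range ρ) 1≤k ≤-refl)) (proj₂ (ones-range ρ) ≤-refl)
    ; X-∈ = there (X-∈ ρ)
    ; X-∉ = X-absent
    ; ones-range = ones-snoc (ones-range ρ)
    }
    where
    X-absent : ∀ {i} → suc l < i → X i ∉ ones (suc k) ∷ D
    X-absent {suc i} l<i (here eq) = X≢ones {i} {suc k} eq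
    X-absent l<i (there X∈D) = X-∉ ρ l<i X∈D

  X≡3 : X 3 ≡ false ∷ true ∷ true ∷ []
  X≡3 rewrite x₀ | x₁ | x₂ = refl

  longer : ∀ f i {D : List Word} {m} {_ : True (All.all? (λ u → length u ≤? m) D)} → m < i → seg f 0 i ∉ D
  longer f i {m = m} {short} m<i u∈D =
    <⇒≱ m<i (subst (_≤ m) (length-seg 0 i) (All.lookup (toWitness short) u∈D))

  ones-head : ∀ i → ones (suc i) ≡ true ∷ ones i
  ones-head zero = refl
  ones-head (suc i) = cong (_∷ʳ true) (ones-head i)

  ones≢0∷ : ∀ {i u} → ones i ≢ false ∷ u
  ones≢0∷ {suc i} eq with trans (sym (ones-head i)) eq
  ... | ()

  ready-preamble : Ready preamble-blocks 3 3
  ready-preamble = record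
    { valid = extend (extend (extend (extend (extend (extend empty
        [] false) [] true) (false ∷ []) true) (true ∷ []) true) (false ∷ true ∷ []) true) (true ∷ true ∷ []) true
    ; X-∈ = there (here X≡3)
    ; X-∉ = λ {i} → longer x i
    ; ones-range = present , λ {i} → longer (λ _ → true) i
    }
    where
    present : ∀ {i} → 1 ≤ i → i ≤ 3 → ones i ∈ preamble-blocks
    present {1} _ _ = member
    present {2} _ _ = member
    present {3} _ _ = member
    present {suc (suc (suc (suc i)))} _ (s≤s (s≤s (s≤s ())))

  ready-preamble₀ : Ready preamble-blocks₀ 3 2
  ready-preamble₀ = record
    { valid = extend (extend (extend (extend (extend (extend empty
        [] false) (false ∷ []) true) (false ∷ true ∷ []) true) [] true) (false ∷ true ∷ true ∷ []) true) (true ∷ []) true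
    ; X-∈ = there (there (there (here X≡3)))
    ; X-∉ = X-absent
    ; ones-range = present , absent
    }
    where
    present : ∀ {i} → 1 ≤ i → i ≤ 2 → ones i ∈ preamble-blocks₀
    present {1} _ _ = member
    present {2} _ _ = member
    present {suc (suc (suc i))} _ (s≤s (s≤s ()))
    absent : ∀ {i} → 2 < i → ones i ∉ preamble-blocks₀
    absent {i} _ (there (here eq)) = ones≢0∷ {i} eq
    absent {i} _ (there (there (there (here eq)))) = ones≢0∷ {i} eq
    absent {i} 2<i (here eq) = longer (λ _ → true) i 2<i (here {xs = []} eq)
    absent {i} 2<i (there (there (here eq))) = longer (λ _ → true) i 2<i (here {xs = []} eq)
    absent {i} 2<i (there (there (there (there ones∈)))) = longer (λ _ → true) i 2<i ones∈
    X-absent : ∀ {i} → 3 < i → X i ∉ preamble-blocks₀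
    X-absent {4} _ (there (here eq)) with trans (sym x₃) (∷ʳ-injectiveʳ (X 3) (false ∷ true ∷ true ∷ []) eq)
    ... | ()
    X-absent {4} _ (here eq) = longer x 4 {m = 3} ≤-refl (here {xs = []} eq)
    X-absent {4} _ (there (there h)) = longer x 4 {m = 3} ≤-refl h
    X-absent {suc (suc (suc (suc (suc i))))} _ h = longer x (5 + i) {m = 4} (s≤s (s≤s (s≤s (s≤s (s≤s z≤n))))) h
    X-absent {1} (s≤s ())
    X-absent {2} (s≤s (s≤s ()))
    X-absent {3} (s≤s (s≤s (s≤s ())))

  -- Phase 1: the lines `X 4`, ..., `X n₁`, which both parsers take as whole blocks since both
  -- preambles contain `X 3`.
  lines : ℕ → List Word → List Word
  lines zero    D = D
  lines (suc i) D = X (4 + i) ∷ lines i D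

  ready-lines : ∀ {D k} i → Ready D 3 k → Ready (lines i D) (3 + i) k
  ready-lines zero    ρ = ρ
  ready-lines (suc i) ρ = ready-line (ready-lines i ρ)

  -- Within line j: the next letter is a 1 of the gadget preceding it while `gadget` > 0, and X[offset] afterwards, with
  -- `remaining` letters of the line left after that one.  The next gadget to be scheduled is 1^(2 + κ).
  record Position : Set where
    constructor position
    field
      line offset remaining gadget κ : ℕ

  letter : Position → Bool
  letter (position _ p _ zero _)    = x p
  letter (position _ _ _ (suc _) _) = true

  -- The flag says whether the parser of 0w has just completed a block; it is consulted only after
  -- the last letter of a line.
  move : Position → Bool → Position
  move (position j p q (suc r) κ)     _     = position j p q r κ
  move (position j p (suc q) zero κ)  _     = position j (suc p) q zero κ
  move (position j p zero zero κ)     false = position (suc j) 0 (n₁ + suc j) zero κ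
  move (position j p zero zero κ)     true  = position (suc j) 0 (n₁ + suc j) (2 + κ) (suc κ)

  -- The letters are generated together with the run of the parser of 0w on them (after phase 1), since a gadget is
  -- inserted exactly when that parser completes a block at the end of a line.
  run : ℕ → Position × List Word × Word
  run zero = position 0 0 n₁ 4 3 , lines h preamble-blocks₀ , []
  run (suc g) = move P (null v) , D′ , v
    where
    P = proj₁ (run g)
    pushed = push (proj₁ (proj₂ (run g))) (proj₂ (proj₂ (run g)) ∷ʳ letter P)
    D′ = proj₁ pushed
    v = proj₂ pushed

  pos : ℕ → Position
  pos g = proj₁ (run g)

  t : ℕ → Bool
  t g = letter (pos g)

  dict₀ : ℕ → List Word
  dict₀ g = proj₁ (proj₂ (run g))

  pending : ℕ → Word
  pending g = proj₂ (proj₂ (run g))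

  open module Parser₀ = Parsing t dict₀ pending refl (λ g → push-spec (dict₀ g) (pending g ∷ʳ t g)) hiding (dictionary)
  open Boundaries Bd
  open Search Bd? refl

  -- The positions [E j, S j) are those of the gadget preceding line j, and [S j, E (suc j)) those of line j.
  mutual
    E S : ℕ → ℕ
    E zero    = 0
    E (suc j) = S j + suc (n₁ + j)
    S j       = E j + gadget j

    gadget : ℕ → ℕ
    gadget j = Position.gadget (pos (E j))

  with-gadget : ℕ → List Word → List Word
  with-gadget zero    D = D
  with-gadget (suc r) D = ones (suc r) ∷ D

  -- The dictionary of the parser of w at `E j`, in closed form: every gadget and every line is one
  -- block of w.
  dict : ℕ → List Word
  dict zero    = lines h preamble-blocks
  dict (suc j) = X (suc (n₁ + j)) ∷ with-gadget (gadget j) (dict j)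

  gadget-pos : ∀ {j p q r κ} i {g} → pos g ≡ position j p q (i + r) κ → pos (g + i) ≡ position j p q r κ
  gadget-pos zero {g} eq = trans (cong pos (+-identityʳ g)) eq
  gadget-pos (suc i) {g} eq = trans (cong pos (+-suc g i))
    (gadget-pos i {suc g} (cong (λ P → move P (null (pending (suc g)))) eq))

  line-pos : ∀ {j p q κ} i {g} → pos g ≡ position j p (i + q) 0 κ → pos (g + i) ≡ position j (i + p) q 0 κ
  line-pos zero {g} eq = trans (cong pos (+-identityʳ g)) eq
  line-pos {j} {p} {q} {κ} (suc i) {g} eq = trans (cong pos (+-suc g i)) (trans
    (line-pos i {suc g} (cong (λ P → move P (null (pending (suc g)))) eq)) (cong (λ k → position j k q 0 κ) (+-suc i p)))

  -- In both cases w is ahead of 0w by exactly one block 1ⁱ. In the synced case `move` has already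
  -- raised the counter for the coming gadget.
  data LineEnd (j κ : ℕ) : Set where
    plain : gadget j ≡ 0 → ¬ Bd (E j) → 2 ≤ κ → OnesUpTo (dict₀ (E j)) κ → Ready (dict j) (n₁ + j) (suc κ) → LineEnd j κ
    synced : ∀ {κ′} → κ ≡ suc κ′ → gadget j ≡ suc κ → Bd (E j) → 2 ≤ κ′ → OnesUpTo (dict₀ (E j)) κ′ →
      Ready (dict j) (n₁ + j) κ → LineEnd j κ

  record AtEnd (j : ℕ) : Set where
    field
      κ : ℕ
      κ≤ : κ ≤ 3 + j
      pos-E : pos (E j) ≡ position j 0 (n₁ + j) (gadget j) κ
      state : LineEnd j κ

  record AtStart (j : ℕ) : Set where
    field
      κ : ℕ
      κ≤ : κ ≤ 3 + j
      2≤κ : 2 ≤ κ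
      pos-S : pos (S j) ≡ position j 0 (n₁ + j) 0 κ
      ¬Bd-S : ¬ Bd (S j)
      ones-D : OnesUpTo (dict₀ (S j)) κ
      ready-W : Ready (with-gadget (gadget j) (dict j)) (n₁ + j) (suc κ)
      -- A gadget has a boundary at its start and one a single letter before its end; `location`
      -- uses both to exclude long blocks there.
      before : gadget j ≡ 0 ⊎ (gadget j ≡ suc κ × Bd (E j) × Bd (E j + κ))

  gadget-letter : ∀ {g j p q r κ i} → pos g ≡ position j p q r κ → i < r → t (g + i) ≡ true
  gadget-letter {g} {j} {p} {q} {κ = κ} {i} eq i<r with m≤n⇒∃[o]m+o≡n i<r
  ... | o , refl = cong letter (gadget-pos i {g} (trans eq (cong (λ r → position j p q r κ) (sym (+-suc i o)))))

  step-new : ∀ g {v D} → pending g ∷ʳ t g ≡ v → dict₀ g ≡ D → v ∉ D →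
    pending (suc g) ≡ [] × dict₀ (suc g) ≡ v ∷ D
  step-new g refl refl v∉D with push-spec (dict₀ g) (pending g ∷ʳ t g)
  ... | inj₁ (eq , _ , eqD) = eq , eqD
  ... | inj₂ (_ , v∈D , _) = ⊥-elim (v∉D v∈D)

  step-old : ∀ g {v D} → pending g ∷ʳ t g ≡ v → dict₀ g ≡ D → v ∈ D →
    pending (suc g) ≡ v × dict₀ (suc g) ≡ D
  step-old g refl refl v∈D with push-spec (dict₀ g) (pending g ∷ʳ t g)
  ... | inj₁ (_ , v∉D , _) = ⊥-elim (v∉D v∈D)
  ... | inj₂ (eq , _ , eqD) = eq , eqD

  gadget-run : ∀ {e j q κ} → pos e ≡ position j 0 q (2 + κ) (suc κ) → Bd e → OnesUpTo (dict₀ e) κ →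
    ∀ i → i ≤ κ → pending (e + i) ≡ ones i × dict₀ (e + i) ≡ dict₀ e
  gadget-run {e} pe bd o zero _ = trans (cong pending (+-identityʳ e)) bd , cong dict₀ (+-identityʳ e)
  gadget-run {e} pe bd o (suc i) 1+i≤κ with gadget-run {e} pe bd o i (<⇒≤ 1+i≤κ)
  ... | π≡ , D≡ = subst (λ g → pending g ≡ ones (suc i) × dict₀ g ≡ dict₀ e) (sym (+-suc e i))
          (step-old (e + i) (cong₂ _∷ʳ_ π≡ (gadget-letter {e} pe (<-trans 1+i≤κ (m<n⇒m<1+n ≤-refl)))) D≡
            (proj₁ o (s≤s z≤n) 1+i≤κ))

  -- The parser of 0w lags by one on the blocks 1ⁱ: it cuts the gadget 1^(2 + κ) as 1^(1 + κ) | 1 and goes on with 1X.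
  gadget-end : ∀ {e j q κ} → pos e ≡ position j 0 q (2 + κ) (suc κ) → Bd e → 1 ≤ κ → OnesUpTo (dict₀ e) κ →
    Bd (e + suc κ) × ¬ Bd (e + (2 + κ)) × OnesUpTo (dict₀ (e + (2 + κ))) (suc κ)
  gadget-end {e} {κ = κ} pe bd 1≤κ o = bd₁ , ¬bd₂ , subst (λ D → OnesUpTo D (suc κ)) (sym (proj₂ second)) (ones-snoc o)
    where
    first : pending (e + suc κ) ≡ [] × dict₀ (e + suc κ) ≡ ones (suc κ) ∷ dict₀ e
    first with gadget-run {e} pe bd o κ ≤-refl
    ... | π≡ , D≡ = subst (λ g → pending g ≡ [] × dict₀ g ≡ ones (suc κ) ∷ dict₀ e) (sym (+-suc e κ))
            (step-new (e + κ) (cong₂ _∷ʳ_ π≡ (gadget-letter {e} pe (m<n⇒m<1+n (n<1+n κ)))) D≡ (proj₂ o (n<1+n κ)))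

    bd₁ : Bd (e + suc κ)
    bd₁ = proj₁ first

    second : pending (e + (2 + κ)) ≡ ones 1 × dict₀ (e + (2 + κ)) ≡ ones (suc κ) ∷ dict₀ e
    second = subst (λ g → pending g ≡ ones 1 × dict₀ g ≡ ones (suc κ) ∷ dict₀ e) (sym (+-suc e (suc κ)))
      (step-old (e + suc κ) (cong₂ _∷ʳ_ bd₁ (gadget-letter {e} pe ≤-refl)) (proj₂ first) (there (proj₁ o ≤-refl 1≤κ)))

    ¬bd₂ : ¬ Bd (e + (2 + κ))
    ¬bd₂ bd′ with trans (sym bd′) (proj₁ second)
    ... | ()

  at-start : ∀ {j} → AtEnd j → AtStart j
  at-start {j} record { κ = κ ; κ≤ = κ≤ ; pos-E = pe ; state = plain r≡0 ¬bd 2≤κ o w } = record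
    { κ = κ ; κ≤ = κ≤ ; 2≤κ = 2≤κ
    ; pos-S = trans (cong pos S≡E) (trans pe (cong (λ r → position j 0 (n₁ + j) r κ) r≡0))
    ; ¬Bd-S = subst (¬_ ∘ Bd) (sym S≡E) ¬bd
    ; ones-D = subst (λ g → OnesUpTo (dict₀ g) κ) (sym S≡E) o
    ; ready-W = subst (λ r → Ready (with-gadget r (dict j)) (n₁ + j) (suc κ)) (sym r≡0) w
    ; before = inj₁ r≡0 }
    where
    S≡E : S j ≡ E j
    S≡E = trans (cong (E j +_) r≡0) (+-identityʳ (E j))
  at-start {j} record { κ = .(suc κ) ; κ≤ = κ≤ ; pos-E = pe ; state = synced {κ} refl r≡ bd 2≤κ o w } = record
    { κ = suc κ ; κ≤ = κ≤ ; 2≤κ = m≤n⇒m≤1+n 2≤κ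
    ; pos-S = trans (cong pos S≡)
        (gadget-pos (2 + κ) {E j} (trans pe′ (cong (λ r → position j 0 (n₁ + j) r (suc κ)) (sym (+-identityʳ (2 + κ))))))
    ; ¬Bd-S = subst (¬_ ∘ Bd) (sym S≡) (proj₁ (proj₂ ended))
    ; ones-D = subst (λ g → OnesUpTo (dict₀ g) (suc κ)) (sym S≡) (proj₂ (proj₂ ended))
    ; ready-W = subst (λ r → Ready (with-gadget r (dict j)) (n₁ + j) (2 + κ)) (sym r≡) (ready-ones (s≤s z≤n) w)
    ; before = inj₂ (r≡ , bd , proj₁ ended) }
    where
    S≡ : S j ≡ E j + (2 + κ)
    S≡ = cong (E j +_) r≡
    pe′ : pos (E j) ≡ position j 0 (n₁ + j) (2 + κ) (suc κ)
    pe′ = trans pe (cong (λ r → position j 0 (n₁ + j) r (suc κ)) r≡)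
    ended = gadget-end {E j} pe′ bd (≤-trans (s≤s z≤n) 2≤κ) o

  line-letter : ∀ {j p κ} → pos (S j) ≡ position j 0 (n₁ + j) 0 κ → p ≤ n₁ + j → t (S j + p) ≡ x p
  line-letter {j} {p} {κ} ps p≤ with m≤n⇒∃[o]m+o≡n p≤
  ... | o , eq = trans (cong letter (line-pos p {S j} (trans ps (cong (λ q → position j 0 q 0 κ) (sym eq)))))
                   (cong x (+-identityʳ p))

  -- The last three letters of such a block include X[0] = 0 if `p ≤ 1`, and form a factor 111 of X
  -- otherwise.
  no-ones-block : ∀ {j p κ a d} → pos (S j) ≡ position j 0 (n₁ + j) 0 κ → p ≤ n₁ + j → a + d ≡ S j + p → 2 ≤ d →
    (∀ {r} → r < suc d → t (a + r) ≡ true) → ⊥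
  no-ones-block {d = suc zero} _ _ _ (s≤s ())
  no-ones-block {j} {p} {κ} {a} {suc (suc d)} ps p≤ eq _ all-ones = by-offset p p≤ eq
    where
    at : ∀ p → p ≤ n₁ + j → ∀ {k} → a + k ≡ S j + p → k ≤ 2 + d → x p ≡ true
    at p p≤ a+k≡ k≤ = trans (sym (line-letter ps p≤)) (trans (cong t (sym a+k≡)) (all-ones (s≤s k≤)))

    by-offset : ∀ p → p ≤ n₁ + j → a + (2 + d) ≡ S j + p → ⊥
    by-offset zero p≤ eq with trans (sym x₀) (at 0 p≤ eq ≤-refl)
    ... | ()
    by-offset (suc zero) p≤ eq
      with trans (sym x₀) (at 0 z≤n (suc-injective (trans (sym (+-suc a (suc d))) (trans eq (+-suc (S j) 0)))) (n≤1+n _))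
    ... | ()
    by-offset (suc (suc p)) p≤ eq = no-111
      (at p (≤-trans (m≤n+m p 2) p≤) (suc-injective (trans (sym (+-suc a d)) (trans eq₁ (+-suc (S j) p)))) (m≤n+m d 2))
      (at (suc p) (<⇒≤ p≤) eq₁ (n≤1+n _))
      (at (2 + p) p≤ eq ≤-refl)
      where
      eq₁ : a + suc d ≡ S j + suc p
      eq₁ = suc-injective (trans (sym (+-suc a (suc d))) (trans eq (+-suc (S j) (suc p))))

  -- No block 1ⁱ is added while a line is read: a new one would have `i > κ ≥ 2`, hence at least
  -- three letters, against `no-ones-block`.
  ones-in-line : ∀ {j} (s : AtStart j) → let open AtStart s in
    ∀ p → p ≤ suc (n₁ + j) → OnesUpTo (dict₀ (S j + p)) κ
  ones-in-line {j} s zero _ = subst (λ g → OnesUpTo (dict₀ g) κ) (sym (+-identityʳ (S j))) ones-D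
    where open AtStart s
  ones-in-line {j} s (suc p) (s≤s p≤) =
    subst (λ g → OnesUpTo (dict₀ g) κ) (sym (+-suc (S j) p))
      ((λ 1≤i i≤κ → D-step (S j + p) (proj₁ before-p 1≤i i≤κ)) , absent)
    where
    open AtStart s
    before-p : OnesUpTo (dict₀ (S j + p)) κ
    before-p = ones-in-line s p (m≤n⇒m≤1+n p≤)
    absent : ∀ {i} → κ < i → ones i ∉ dict₀ (suc (S j + p))
    absent {i} κ<i ∈D with push-spec (dict₀ (S j + p)) (pending (S j + p) ∷ʳ t (S j + p))
    ... | inj₂ (_ , _ , eqD) = proj₂ before-p κ<i (subst (ones i ∈_) eqD ∈D)
    ... | inj₁ (_ , _ , eqD) with subst (ones i ∈_) eqD ∈D
    ... | there ∈D′ = proj₂ before-p κ<i ∈D′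
    ... | here eq with last (S j + p)
    ... | a , d , a+d≡ , bda , free
      with trans eq (cong₂ _∷ʳ_ (trans (cong pending (sym a+d≡)) (partial {a} d bda free)) (cong t (sym a+d≡)))
    ... | eq′ with seg-length-injective i (suc d) eq′
    ... | refl = no-ones-block pos-S p≤ a+d≡ (≤-trans 2≤κ (s≤s⁻¹ κ<i)) (λ r< → sym (seg-letters (suc d) eq′ r<))

  at-end : ∀ {j} → AtStart j → AtEnd (suc j)
  at-end {j} s = by-sync (Bd? (E (suc j)))
    where
    open AtStart s
    pos-last : pos (S j + (n₁ + j)) ≡ position j (n₁ + j) 0 0 κ
    pos-last = trans (line-pos (n₁ + j) {S j} (trans pos-S (cong (λ q → position j 0 q 0 κ) (sym (+-identityʳ (n₁ + j))))))
      (cong (λ p → position j p 0 0 κ) (+-identityʳ (n₁ + j)))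
    pos-next : ∀ b → null (pending (E (suc j))) ≡ b → pos (E (suc j)) ≡ move (position j (n₁ + j) 0 0 κ) b
    pos-next b nb = trans (cong pos (+-suc (S j) (n₁ + j))) (cong₂ move pos-last
      (trans (cong (null ∘ pending) (sym (+-suc (S j) (n₁ + j)))) nb))
    o : OnesUpTo (dict₀ (E (suc j))) κ
    o = ones-in-line s (suc (n₁ + j)) ≤-refl
    w : Ready (dict (suc j)) (n₁ + suc j) (suc κ)
    w = subst (λ l → Ready (dict (suc j)) l (suc κ)) (sym (+-suc n₁ j)) (ready-line ready-W)
    null≡ : ∀ (v : Word) → v ≢ [] → null v ≡ false
    null≡ [] v≢[] = ⊥-elim (v≢[] refl)
    null≡ (_ ∷ _) _ = refl
    by-sync : Dec (Bd (E (suc j))) → AtEnd (suc j)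
    by-sync (yes bd) = record
      { κ = suc κ ; κ≤ = subst (suc κ ≤_) (sym (+-suc 3 j)) (s≤s κ≤)
      ; pos-E = trans pn (cong (λ r → position (suc j) 0 (n₁ + suc j) r (suc κ)) (sym (cong Position.gadget pn)))
      ; state = synced refl (cong Position.gadget pn) bd 2≤κ o w }
      where
      pn : pos (E (suc j)) ≡ position (suc j) 0 (n₁ + suc j) (2 + κ) (suc κ)
      pn = pos-next true (cong null bd)
    by-sync (no ¬bd) = record
      { κ = κ ; κ≤ = ≤-trans κ≤ (+-monoʳ-≤ 3 (n≤1+n j))
      ; pos-E = trans pn (cong (λ r → position (suc j) 0 (n₁ + suc j) r κ) (sym (cong Position.gadget pn)))
      ; state = plain (cong Position.gadget pn) ¬bd 2≤κ o w }
      where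
      pn : pos (E (suc j)) ≡ position (suc j) 0 (n₁ + suc j) 0 κ
      pn = pos-next false (null≡ _ ¬bd)

  ends : ∀ j → AtEnd j
  ends zero = record
    { κ = 3 ; κ≤ = ≤-refl ; pos-E = cong (λ q → position 0 0 q 4 3) (sym (+-identityʳ n₁))
    ; state = synced refl refl refl ≤-refl (Ready.ones-range (ready-lines h ready-preamble₀))
        (subst (λ l → Ready (dict 0) l 3) (sym (+-identityʳ n₁)) (ready-lines h ready-preamble)) }
  ends (suc j) = at-end (at-start (ends j))

  starts : ∀ j → AtStart j
  starts j = at-start (ends j)

  gadget-t : ∀ {j i} → i < gadget j → t (E j + i) ≡ true
  gadget-t {j} = gadget-letter {E j} (AtEnd.pos-E (ends j))

  line-t : ∀ {j p} → p ≤ n₁ + j → t (S j + p) ≡ x p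
  line-t {j} = line-letter {j} (AtStart.pos-S (starts j))

  dict-ready : ∀ j → ∃ λ k → Ready (dict j) (n₁ + j) k
  dict-ready j with AtEnd.state (ends j)
  ... | plain _ _ _ _ ρ = _ , ρ
  ... | synced _ _ _ _ _ ρ = _ , ρ

  flatten-gadget : ∀ r D → flatten (with-gadget r D) ≡ flatten D ++ ones r
  flatten-gadget zero    D = sym (++-identityʳ (flatten D))
  flatten-gadget (suc r) D = refl

  -- The letters `t` were generated along the parser of 0w; this shows that the closed-form
  -- dictionary of w spells the same text.
  dict-text : ∀ j → flatten (dict j) ≡ flatten (dict 0) ++ seg t 0 (E j)
  dict-text zero = sym (++-identityʳ _)
  dict-text (suc j) = begin
    flatten (with-gadget r (dict j)) ++ X m              ≡⟨ cong (_++ X m) (flatten-gadget r (dict j)) ⟩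
    (flatten (dict j) ++ ones r) ++ X m                  ≡⟨ cong (λ u → (u ++ ones r) ++ X m) (dict-text j) ⟩
    ((w₁ ++ seg t 0 (E j)) ++ ones r) ++ X m             ≡⟨ cong (_++ X m) (++-assoc w₁ (seg t 0 (E j)) (ones r)) ⟩
    (w₁ ++ (seg t 0 (E j) ++ ones r)) ++ X m             ≡⟨ ++-assoc w₁ _ (X m) ⟩
    w₁ ++ ((seg t 0 (E j) ++ ones r) ++ X m)             ≡⟨ cong₂ (λ u v → w₁ ++ ((seg t 0 (E j) ++ u) ++ v)) gadget-seg line-seg ⟨
    w₁ ++ ((seg t 0 (E j) ++ seg t (E j) r) ++ seg t (S j) m) ≡⟨ cong (λ u → w₁ ++ (u ++ seg t (S j) m)) (seg-++ 0 (E j) r) ⟨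
    w₁ ++ (seg t 0 (S j) ++ seg t (S j) m)               ≡⟨ cong (w₁ ++_) (seg-++ 0 (S j) m) ⟨
    w₁ ++ seg t 0 (E (suc j))                            ∎
    where
    open ≡-Reasoning
    w₁ = flatten (dict 0)
    r = gadget j
    m = suc (n₁ + j)
    gadget-seg : seg t (E j) r ≡ ones r
    gadget-seg = seg-cong r (gadget-t {j})
    line-seg : seg t (S j) m ≡ X m
    line-seg = seg-cong m (λ r<m → line-t {j} (s≤s⁻¹ r<m))

  lines-length : ∀ i D → length (lines i D) ≡ i + length D
  lines-length zero    D = refl
  lines-length (suc i) D = cong suc (lines-length i D)

  dict-length : ∀ j → length (dict j) ≤ h + 6 + (j + j)
  dict-length zero = ≤-reflexive (trans (lines-length h preamble-blocks) (sym (+-identityʳ (h + 6))))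
  dict-length (suc j) = ≤-trans (s≤s (≤-trans (at-most-one (gadget j)) (s≤s (dict-length j))))
      (≤-reflexive (two-more (h + 6) j))
    where
    at-most-one : ∀ r → length (with-gadget r (dict j)) ≤ suc (length (dict j))
    at-most-one zero    = n≤1+n _
    at-most-one (suc r) = ≤-refl

  -- Twice the sum of the 12 letters of the preamble and 4 + 5 + ... + (3 + i), doubled to avoid a
  -- division.
  lines-flatten-length : ∀ i {D} → length (flatten D) ≡ 12 →
    2 * length (flatten (lines i D)) ≡ (3 + i) * (4 + i) + 12
  lines-flatten-length zero eq = cong (2 *_) eq
  lines-flatten-length (suc i) {D} eq = trans
    (cong (2 *_) (trans (length-++ (flatten (lines i D))) (cong (length (flatten (lines i D)) +_) (length-seg 0 (4 + i)))))
    (trans (*-distribˡ-+ 2 (length (flatten (lines i D))) (4 + i))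
      (trans (cong (_+ 2 * (4 + i)) (lines-flatten-length i eq)) (next-triangular i)))

  lines-flatten-0∷ : ∀ i {D D′} → flatten D′ ≡ false ∷ flatten D → flatten (lines i D′) ≡ false ∷ flatten (lines i D)
  lines-flatten-0∷ zero eq = eq
  lines-flatten-0∷ (suc i) eq = cong (_++ X (4 + i)) (lines-flatten-0∷ i eq)

  E-lower : ∀ j → j * n₁ ≤ E j
  E-lower zero = z≤n
  E-lower (suc j) = ≤-trans (≤-reflexive (+-comm n₁ (j * n₁))) (+-mono-≤ (≤-trans (E-lower j) (m≤m+n (E j) (gadget j)))
    (≤-trans (m≤m+n n₁ j) (n≤1+n _)))

  gadget≤ : ∀ j → gadget j ≤ 4 + j
  gadget≤ j with AtStart.before (starts j)
  ... | inj₁ none = ≤-trans (≤-reflexive none) z≤n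
  ... | inj₂ (some , _) = ≤-trans (≤-reflexive some) (s≤s (AtStart.κ≤ (starts j)))

  E-upper : ∀ {N} j → j ≤ N → E j ≤ j * (n₁ + (N + N) + 5)
  E-upper zero _ = z≤n
  E-upper {N} (suc j) j<N = ≤-trans
    (+-mono-≤ (+-mono-≤ (E-upper j (<⇒≤ j<N)) (≤-trans (gadget≤ j) (+-monoʳ-≤ 4 (<⇒≤ j<N))))
      (s≤s (+-monoʳ-≤ n₁ (<⇒≤ j<N))))
    (≤-reflexive (line-cost j n₁ N))

-- Occurrences of factors of X among the blocks of 0w

module Analysis
  (x : ℕ → Bool)
  (x₀ : x 0 ≡ false) (x₁ : x 1 ≡ true) (x₂ : x 2 ≡ true) (x₃ : x 3 ≡ false)
  (no-111 : ∀ {p} → x p ≡ true → x (1 + p) ≡ true → x (2 + p) ≡ true → ⊥)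
  (A bound : ℕ) (3≤A : 3 ≤ A)
  (unique : ∀ {p q} → p < bound → q < bound → (∀ {r} → r < A → x (p + r) ≡ x (q + r)) → p ≡ q)
  (h R : ℕ) (1≤R : 1 ≤ R)
  (A≤n₁ : A ≤ 3 + h) (in-bound : 3 + h + R * R + A < bound)
  where

  open Construction x x₀ x₁ x₂ x₃ no-111 h
  open Parser₀
  open Boundaries Bd
  open Search Bd? refl

  -- A window of length `2A` crossing from one line directly into the next keeps a full factor of
  -- length `A` on at least one side.
  N B : ℕ
  N = R * R
  B = A + A

  A≤B : A ≤ B
  A≤B = m≤m+n A A

  n₁+N<bound : n₁ + N < bound
  n₁+N<bound = ≤-<-trans (m≤m+n (n₁ + N) A) in-bound

  n₁+A<bound : n₁ + A < bound
  n₁+A<bound = ≤-<-trans (+-monoˡ-≤ A (m≤m+n n₁ N)) in-bound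

  E-mono : ∀ {j k} → j ≤ k → E j ≤ E k
  E-mono {j} {k} j≤k with m≤n⇒∃[o]m+o≡n j≤k
  ... | o , refl = go o
    where
    go : ∀ o → E j ≤ E (j + o)
    go zero = ≤-reflexive (cong E (sym (+-identityʳ j)))
    go (suc o) = ≤-trans (go o) (≤-trans (≤-trans (m≤m+n (E (j + o)) (gadget (j + o))) (m≤m+n (S (j + o)) _))
                   (≤-reflexive (cong E (sym (+-suc j o)))))

  line-end : ∀ {j k p} → j < k → p ≤ suc (n₁ + j) → S j + p ≤ E k
  line-end {j} j<k p≤ = ≤-trans (+-monoʳ-≤ (S j) p≤) (E-mono j<k)

  S-separated : ∀ {j k p} → j < k → p ≤ n₁ → S j + p < S k
  S-separated {j} {k} {p} j<k p≤n₁ = ≤-trans (≤-reflexive (sym (+-suc (S j) p)))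
    (≤-trans (line-end j<k (s≤s (≤-trans p≤n₁ (m≤m+n n₁ j)))) (m≤m+n (E k) (gadget k)))

  S-cancel : ∀ {j k p q} → p ≤ n₁ → q ≤ n₁ → S j + p ≡ S k + q → j ≡ k
  S-cancel {j} {k} {p} {q} p≤ q≤ eq with <-cmp j k
  ... | tri≈ _ j≡k _ = j≡k
  ... | tri< j<k _ _ = ⊥-elim (<⇒≢ (<-≤-trans (S-separated j<k p≤) (m≤m+n (S k) q)) eq)
  ... | tri> _ _ k<j = ⊥-elim (<⇒≢ (<-≤-trans (S-separated k<j q≤) (m≤m+n (S j) p)) (sym eq))

  locate : ∀ k {g} → g < E k → ∃ λ j → j < k × ((E j ≤ g × g < S j) ⊎ ∃ λ p → p ≤ n₁ + j × g ≡ S j + p)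
  locate (suc k) {g} g<E with g <? E k
  ... | yes g< with locate k g<
  ... | j , j<k , where-g = j , m<n⇒m<1+n j<k , where-g
  locate (suc k) {g} g<E | no g≮ with g <? S k
  ... | yes g<S = k , ≤-refl , inj₁ (≮⇒≥ g≮ , g<S)
  ... | no g≮S with m≤n⇒∃[o]m+o≡n (≮⇒≥ g≮S)
  ... | o , refl = k , ≤-refl , inj₂ (o , s≤s⁻¹ (+-cancelˡ-< (S k) o (suc (n₁ + k)) g<E) , refl)

  Inner : ℕ → Set
  Inner g = ∀ {i} → 1 ≤ i → i < B → ¬ Bd (g + i)

  -- A boundary-free window of length 2A carrying factor p of X can neither lie in a gadget nor contain the beginning
  -- of a line, so it starts at offset p of a line.
  location : ∀ {g p} → g + B ≤ E N → p + A < bound → Inner g → (∀ {r} → r < B → t (g + r) ≡ x (p + r)) →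
    ∃ λ j → j < N × g ≡ S j + p
  location {g} {p} g+B≤ p+A< inner letters
    with locate N (≤-trans (≤-trans (≤-reflexive (+-comm 1 g)) (+-monoʳ-≤ g (≤-trans (≤-trans (s≤s z≤n) 3≤A) A≤B))) g+B≤)
  ... | j , j<N , inj₁ (E≤g , g<S) = ⊥-elim (in-gadget (AtStart.before (starts j)))
    where
    open AtStart (starts j) using (κ)

    -- Only the last letter of the gadget would precede the line in the window, so X[0..A) would
    -- recur at offset `p + 1`.
    next-line : suc g ≡ S j → ⊥
    next-line eq = 0≢1+n (unique (≤-<-trans z≤n p+A<)
      (≤-<-trans (≤-trans (≤-reflexive (+-comm 1 p)) (+-monoʳ-≤ p (≤-trans (s≤s z≤n) 3≤A))) p+A<)
      λ {r} r<A → trans (sym (line-t (≤-trans (<⇒≤ r<A) (≤-trans A≤n₁ (m≤m+n n₁ j)))))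
        (trans (cong t (trans (cong (_+ r) (sym eq)) (sym (+-suc g r))))
          (trans (letters (≤-trans (+-mono-≤ (≤-trans (s≤s z≤n) 3≤A) r<A) ≤-refl)) (cong x (+-suc p r)))))

    in-gadget : gadget j ≡ 0 ⊎ (gadget j ≡ suc κ × Bd (E j) × Bd (E j + κ)) → ⊥
    in-gadget (inj₁ none) = <⇒≱ g<S (≤-trans (≤-reflexive (trans (cong (E j +_) none) (+-identityʳ (E j)))) E≤g)
    in-gadget (inj₂ (some , _ , bd)) with m≤n⇒∃[o]m+o≡n E≤g
    ... | i , refl with m≤n⇒∃[o]m+o≡n (s≤s⁻¹ (≤-trans (+-cancelˡ-< (E j) i (gadget j) g<S) (≤-reflexive some)))
    -- Cases on the distance to the boundary one letter before the end of the gadget: 0 leaves a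
    -- single 1 before the line; a positive distance below `B` puts the boundary inside the window;
    -- otherwise the window starts with 111.
    ... | zero , i≡κ = next-line (trans (sym (+-suc (E j) i)) (cong (E j +_)
            (trans (cong suc (trans (sym (+-identityʳ i)) i≡κ)) (sym some))))
    ... | suc o , eq with suc o <? B
    ... | yes o<B = inner (s≤s z≤n) o<B (subst Bd (trans (cong (E j +_) (sym eq)) (sym (+-assoc (E j) i (suc o)))) bd)
    ... | no o≮B = no-111 {p}
          (trans (cong x (sym (+-identityʳ p))) (one 0 (s≤s z≤n)))
          (trans (cong x (sym (+-comm p 1))) (one 1 (s≤s (s≤s z≤n))))
          (trans (cong x (sym (+-comm p 2))) (one 2 ≤-refl))
      where
      one : ∀ r → r < 3 → x (p + r) ≡ true
      one r r<3 = trans (sym (letters (≤-trans r<3 (≤-trans 3≤A A≤B))))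
        (trans (cong t (+-assoc (E j) i r)) (gadget-t {j} {i + r} (≤-trans (s≤s (≤-trans (+-monoʳ-≤ i
          (≤-trans (<⇒≤ r<3) (≤-trans (≤-trans 3≤A A≤B) (≮⇒≥ o≮B)))) (≤-reflexive eq))) (≤-reflexive (sym some)))))
  ... | j , j<N , inj₂ (p′ , p′≤ , refl) = j , j<N , cong (S j +_) (in-line (A ≤? suc (n₁ + j) ∸ p′))
    where
    room : ℕ
    room = suc (n₁ + j) ∸ p′

    p′+room : p′ + room ≡ suc (n₁ + j)
    p′+room = m+[n∸m]≡n (m≤n⇒m≤1+n p′≤)

    1≤room : 1 ≤ room
    1≤room = m<n⇒0<n∸m (s≤s p′≤)

    p<bound : p < bound
    p<bound = ≤-<-trans (m≤m+n p A) p+A<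

    -- Fewer than `A` letters of the window lie in line `j`, so the next line supplies X[0..A),
    -- which would recur at offset `p + room`.
    next-line : room < A → suc j < N → S (suc j) ≡ E (suc j) → ⊥
    next-line room<A 1+j<N S≡E = <⇒≢ (≤-trans 1≤room (m≤n+m room p)) (unique (≤-<-trans z≤n p+A<)
        (≤-<-trans (+-monoʳ-≤ p (<⇒≤ room<A)) p+A<)
        λ {r} r<A → trans (sym (line-t (≤-trans (<⇒≤ r<A) (≤-trans A≤n₁ (m≤m+n n₁ (suc j))))))
          (trans (cong t (trans (cong (_+ r) (trans S≡E (cong (S j +_) (sym p′+room))))
            (trans (cong (_+ r) (sym (+-assoc (S j) p′ room))) (+-assoc (S j + p′) room r))))
          (trans (letters (+-mono-≤ room<A (<⇒≤ r<A))) (cong x (sym (+-assoc p room r))))))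

    in-line : Dec (A ≤ room) → p′ ≡ p
    in-line (yes A≤room) = unique (≤-<-trans (≤-trans p′≤ (+-monoʳ-≤ n₁ (<⇒≤ j<N))) n₁+N<bound) p<bound
      λ {r} r<A → trans (sym (line-t (s≤s⁻¹ (≤-trans (≤-trans (≤-reflexive (sym (+-suc p′ r)))
          (+-monoʳ-≤ p′ (≤-trans r<A A≤room))) (≤-reflexive p′+room)))))
        (trans (cong t (sym (+-assoc (S j) p′ r))) (letters (≤-trans r<A A≤B)))
    -- A window leaving line `j` early passes the end of the text, or enters the next line directly,
    -- or contains the boundary `E (suc j)` at which a gadget starts.
    in-line (no A≰room) with suc j <? N | AtStart.before (starts (suc j))
    ... | no last-line | _ = ⊥-elim (A≰room (≤-trans A≤B (+-cancelˡ-≤ (S j + p′) B room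
            (≤-trans g+B≤ (≤-reflexive (trans (cong E (≤-antisym (≮⇒≥ last-line) j<N))
              (trans (cong (S j +_) (sym p′+room)) (sym (+-assoc (S j) p′ room)))))))))
    ... | yes 1+j<N | inj₁ none = ⊥-elim (next-line (≰⇒> A≰room) 1+j<N (trans (cong (E (suc j) +_) none) (+-identityʳ _)))
    ... | yes 1+j<N | inj₂ (_ , bd , _) = ⊥-elim (inner 1≤room (≤-trans (≰⇒> A≰room) A≤B)
            (subst Bd (trans (cong (S j +_) (sym p′+room)) (sym (+-assoc (S j) p′ room))) bd))

  lines-∈ : ∀ i {D u} → u ∈ lines i D → u ∈ D ⊎ ∃ λ l → l ≤ 3 + i × u ≡ X l
  lines-∈ zero u∈D = inj₁ u∈D
  lines-∈ (suc i) (here eq) = inj₂ (4 + i , ≤-refl , eq)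
  lines-∈ (suc i) (there u∈) with lines-∈ i u∈
  ... | inj₁ u∈D = inj₁ u∈D
  ... | inj₂ (l , l≤ , eq) = inj₂ (l , m≤n⇒m≤1+n l≤ , eq)

  -- Preamble blocks have at most 4 letters, so a block this long is some `X l`; its offset `d` is
  -- then an occurrence of the factor that X has at `p`.
  initial-window : ∀ {a n d p} → seg t a n ∈ dict₀ 0 → d + B ≤ n → p + A < bound →
    (∀ {r} → r < A → t (a + d + r) ≡ x (p + r)) → d ≡ p
  initial-window {a} {n} {d} {p} u∈ d+B≤n p+A< letters with lines-∈ h u∈
  ... | inj₁ u∈pre = ⊥-elim (longer t′ n {m = 4} 4<n (subst (_∈ preamble-blocks₀) (seg-cong n (λ _ → refl)) u∈pre))
    where
    t′ : ℕ → Bool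
    t′ r = t (a + r)
    4<n : 4 < n
    4<n = ≤-trans (≤-trans (m≤n+m 5 1) (≤-trans (+-mono-≤ 3≤A 3≤A) (m≤n+m B d))) d+B≤n
  ... | inj₂ (l , l≤ , eq) with seg-length-injective n l eq
  ... | refl = unique
    (≤-<-trans (≤-trans (m≤m+n d B) (≤-trans d+B≤n l≤)) (≤-<-trans (m≤m+n n₁ A) n₁+A<bound))
    (≤-<-trans (m≤m+n p A) p+A<)
    λ {r} r<A → trans (sym (seg-letters n eq (<-≤-trans (+-monoʳ-< d r<A) (≤-trans (+-monoʳ-≤ d A≤B) d+B≤n))))
      (trans (cong t (sym (+-assoc a d r))) (letters r<A))

  line-factor : ∀ {j p l} → p + l ≤ n₁ → ∀ {r} → r < l → t (S j + p + r) ≡ x (p + r)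
  line-factor {j} {p} {l} p+l≤ {r} r<l = trans (cong t (+-assoc (S j) p r))
    (line-t (≤-trans (≤-trans (+-monoʳ-≤ p (<⇒≤ r<l)) p+l≤) (m≤m+n n₁ j)))

  p+A<bound : ∀ {p l} → p + l ≤ n₁ → p + A < bound
  p+A<bound {p} {l} p+l≤ = ≤-<-trans (+-monoˡ-≤ A (≤-trans (m≤m+n p l) p+l≤)) n₁+A<bound

  inner-window : ∀ {a n d} → Block a n → d + B ≤ n → Inner (a + d)
  inner-window {a} {n} {d} blk d+B≤n {i} 1≤i i<B bd =
    inside blk (≤-trans 1≤i (m≤n+m i d)) (<-≤-trans (+-monoʳ-< d i<B) d+B≤n) (subst Bd (+-assoc a d i) bd)

  -- By `prefix-origin` the stretch is an earlier block. In the initial dictionary it would force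
  -- `p = 0`; otherwise `location` puts it at offset `p` of a line.
  chain : ∀ {j p l} → j < N → 1 ≤ p → B ≤ l → p + l ≤ n₁ → Bd (S j + p) → Free (S j + p) l →
    ∃ λ j′ → j′ < N × Block (S j′ + p) l
  chain {j} {p} {l} j<N 1≤p B≤l p+l≤ bd free
    with prefix-origin bd (≤-trans (≤-trans (≤-trans (s≤s z≤n) 3≤A) A≤B) B≤l) free
  ... | inj₁ initial = ⊥-elim (<⇒≢ 1≤p (initial-window initial B≤l (p+A<bound p+l≤)
          λ {r} r<A → trans (cong (λ g → t (g + r)) (+-identityʳ (S j + p)))
            (line-factor {j} p+l≤ (<-≤-trans r<A (≤-trans A≤B B≤l)))))
  ... | inj₂ (b , b+l≤ , blk , eq)
    with location {b} {p} (≤-trans (+-monoʳ-≤ b B≤l) (≤-trans b+l≤ (≤-trans (≤-reflexive (+-assoc (S j) p l))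
             (line-end j<N (≤-trans p+l≤ (≤-trans (m≤m+n n₁ j) (n≤1+n _)))))))
           (p+A<bound p+l≤)
           (λ 1≤i i<B → inside blk 1≤i (<-≤-trans i<B B≤l))
           (λ r<B → trans (seg-letters l eq (<-≤-trans r<B B≤l)) (line-factor {j} p+l≤ (<-≤-trans r<B B≤l)))
  ... | j′ , j′<N , refl = j′ , j′<N , blk

  -- As for `chain`, with the window placed `d` letters into the block, where the line begins; an
  -- initial block would force `d = 0`.
  crossing : ∀ {j a d i} → j < N → 1 ≤ d → a + d ≡ S j → B ≤ i → i ≤ n₁ → Bd a → Free a (d + i) →
    ∃ λ j′ → j′ < N × ∃ λ a′ → a′ + d ≡ S j′ × Block a′ (d + i)
  crossing {j} {a} {d} {i} j<N 1≤d a+d≡ B≤i i≤n₁ bd free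
    with prefix-origin bd (≤-trans 1≤d (m≤m+n d i)) free
  ... | inj₁ initial = ⊥-elim (<⇒≢ 1≤d (sym (initial-window {a} initial (+-monoʳ-≤ d B≤i) (p+A<bound {0} i≤n₁)
          λ {r} r<A → trans (cong (λ g → t (g + r)) a+d≡)
            (line-t {j} (≤-trans (<⇒≤ r<A) (≤-trans A≤n₁ (m≤m+n n₁ j)))))))
  ... | inj₂ (b , b+n≤ , blk , eq)
    with location {b + d} {0} (≤-trans (≤-reflexive (+-assoc b d B)) (≤-trans (+-monoʳ-≤ b (+-monoʳ-≤ d B≤i))
             (≤-trans b+n≤ (≤-trans (≤-reflexive (trans (sym (+-assoc a d i)) (cong (_+ i) a+d≡)))
               (line-end j<N (≤-trans i≤n₁ (≤-trans (m≤m+n n₁ j) (n≤1+n _))))))))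
           (p+A<bound {0} i≤n₁)
           (inner-window blk (+-monoʳ-≤ d B≤i))
           (λ {r} r<B → trans (cong t (+-assoc b d r)) (trans (seg-letters (d + i) eq (+-monoʳ-< d (<-≤-trans r<B B≤i)))
             (trans (cong t (trans (sym (+-assoc a d r)) (cong (_+ r) a+d≡)))
               (line-t {j} (≤-trans (<⇒≤ (<-≤-trans r<B B≤i)) (≤-trans i≤n₁ (m≤m+n n₁ j)))))))
  ... | j′ , j′<N , eq′ = j′ , j′<N , b , trans eq′ (+-identityʳ _) , blk

  same-line : ∀ {j j′ p l} → j < N → j′ < N → p + l ≤ n₁ → Block (S j + p) l → Block (S j′ + p) l → j ≡ j′
  same-line {j} {j′} {p} {l} _ _ p+l≤ b b′ = S-cancel p≤n₁ p≤n₁ (distinct b b′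
      (seg-cong l (λ r<l → trans (line-factor {j} p+l≤ r<l) (sym (line-factor {j′} p+l≤ r<l)))))
    where
    p≤n₁ : p ≤ n₁
    p≤n₁ = ≤-trans (m≤m+n p l) p+l≤

  open Counting Bd Bd? refl S R B n₁ (≤-trans (≤-trans (s≤s z≤n) 3≤A) A≤B) 1≤R
    (λ {j} _ → AtStart.¬Bd-S (starts j)) chain crossing same-line
    using (K; L; boundary-in-window)

  window-suc : ∀ τ K L → K + K + τ * L + L ≡ K + K + suc τ * L
  window-suc τ K L = solve (τ ∷ K ∷ L ∷ [])

  -- From offset `2K` on, each line holds `M` windows of length `L`, each containing the end of a
  -- block. The word of a block determines its position, hence the line and the window.
  many-blocks : ∀ {M ms} → K + K + M * L + K ≤ n₁ → (∀ {u} → u ∈ dict₀ (E N) → u ∈ ms) → N * M ≤ dictSize ms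
  many-blocks {M} {ms} fits complete = subst (_≤ dictSize ms) size
    (pigeonhole-list Ends (Unique.cartesianProduct⁺ (Unique.upTo⁺ N) (Unique.upTo⁺ M)) total injective)
    where
    size : length (cartesianProduct (upTo N) (upTo M)) ≡ N * M
    size = trans (length-cartesianProduct (upTo N) (upTo M)) (cong₂ _*_ (length-upTo N) (length-upTo M))

    window : ℕ → ℕ
    window τ = K + K + τ * L

    record Ends (jτ : ℕ × ℕ) (u : Word) : Set where
      field
        {a n b} : ℕ
        block : Block a n
        word : u ≡ seg t a n
        ends-at : a + n ≡ S (proj₁ jτ) + b
        above : window (proj₂ jτ) < b
        below : b ≤ window (proj₂ jτ) + L
        b≤n₁ : b ≤ n₁
    open Ends

    separate : ∀ {τ τ′ b} → window τ < b → b ≤ window τ′ + L → τ ≤ τ′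
    separate {τ} {τ′} {b} lo hi with τ ≤? τ′
    ... | yes τ≤τ′ = τ≤τ′
    ... | no τ≰τ′ = ⊥-elim (<⇒≱ lo (≤-trans hi (≤-trans (≤-reflexive (window-suc τ′ K L))
            (+-monoʳ-≤ (K + K) (*-monoˡ-≤ L (≰⇒> τ≰τ′))))))

    injective : ∀ {y z u} → Ends y u → Ends z u → y ≡ z
    injective {j , τ} {j′ , τ′} {u} e f with seg-length-injective (n e) (n f) (trans (sym (word e)) (word f))
    ... | n≡ = cong₂ _,_ j≡ (≤-antisym (separate (above e) (≤-trans (≤-reflexive b≡) (below f)))
                                  (separate (above f) (≤-trans (≤-reflexive (sym b≡)) (below e))))
      where
      a≡ : a e ≡ a f
      a≡ = distinct (block e) (subst (Block (a f)) (sym n≡) (block f))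
        (trans (sym (word e)) (trans (word f) (cong (seg t (a f)) (sym n≡))))
      end≡ : S j + b e ≡ S j′ + b f
      end≡ = trans (sym (ends-at e)) (trans (cong₂ _+_ a≡ n≡) (ends-at f))
      j≡ : j ≡ j′
      j≡ = S-cancel (b≤n₁ e) (b≤n₁ f) end≡
      b≡ : b e ≡ b f
      b≡ = +-cancelˡ-≡ (S j) _ _ (trans end≡ (cong (λ k → S k + b f) (sym j≡)))

    window-end : ∀ {τ} → τ < M → window τ + L ≤ n₁
    window-end {τ} τ<M = ≤-trans (≤-trans (≤-reflexive (window-suc τ K L)) (+-monoʳ-≤ (K + K) (*-monoˡ-≤ L τ<M)))
      (≤-trans (m≤m+n _ K) fits)

    in-window : ∀ {j τ} → j < N → τ < M → (∃ λ b → window τ < b × b ≤ window τ + L × Bd (S j + b)) →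
      ∃ λ u → u ∈ deduplicate _≟w_ ms × Ends (j , τ) u
    in-window {j} {τ} j<N τ<M (b , above , below , bd) =
      finish (block-ending {0} {S j + b} refl (≤-trans (≤-trans (s≤s z≤n) above) (m≤n+m b (S j))) bd)
      where
      b≤ : b ≤ n₁
      b≤ = ≤-trans below (window-end τ<M)
      finish : (∃₂ λ a n → a + n ≡ S j + b × 0 ≤ a × Block a n) → ∃ λ u → u ∈ deduplicate _≟w_ ms × Ends (j , τ) u
      finish (a , n , a+n≡ , _ , blk) = seg t a n ,
        ∈-deduplicate⁺ _≟w_ (complete (D-mono {seg t a n} {a + n} {E N} (≤-trans (≤-reflexive a+n≡)
          (line-end {j} {N} {b} j<N (≤-trans b≤ (≤-trans (m≤m+n n₁ j) (n≤1+n _))))) (block-∈ {a} {n} blk))) ,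
        record { block = blk ; word = refl ; ends-at = a+n≡ ; above = above ; below = below ; b≤n₁ = b≤ }

    total : ∀ {y} → y ∈ cartesianProduct (upTo N) (upTo M) → ∃ λ u → u ∈ deduplicate _≟w_ ms × Ends y u
    total {j , τ} y∈ = in-window j<N τ<M (boundary-in-window {j} {window τ} j<N (m≤m+n (K + K) (τ * L)) (window-end τ<M)
        (≤-trans (+-monoˡ-≤ K (+-monoʳ-≤ (K + K) (*-monoˡ-≤ L (<⇒≤ τ<M)))) fits))
      where
      j<N : j < N
      j<N = ∈-upTo⁻ (proj₁ (∈-cartesianProduct⁻ (upTo N) (upTo M) y∈))
      τ<M : τ < M
      τ<M = ∈-upTo⁻ (proj₂ (∈-cartesianProduct⁻ (upTo N) (upTo M) y∈))

  w : Word
  w = flatten (dict 0) ++ seg t 0 (E N)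

  w-length : ∃ λ l → 2 * l ≡ (3 + h) * (4 + h) + 12 × length w ≡ l + E N
  w-length = length (flatten (dict 0)) , lines-flatten-length h refl ,
    trans (length-++ (flatten (dict 0))) (cong (length (flatten (dict 0)) +_) (length-seg 0 (E N)))

  parse-w : ∃ λ ms → IsLZ78Parsing w ms × dictSize ms ≤ h + 6 + (N + N)
  parse-w = dict N ʳ++ [] ,
    subst (λ u → IsLZ78Parsing u (dict N ʳ++ [])) (dict-text N) (parse-complete (Ready.valid (proj₂ (dict-ready N)))) ,
    ≤-trans (length-deduplicate _≟w_ (dict N ʳ++ []))
      (≤-trans (≤-reflexive (trans (length-ʳ++ (dict N)) (+-identityʳ _))) (dict-length N))

  parse-0w : ∀ M → K + K + M * L + K ≤ n₁ → ∃ λ ms → IsLZ78Parsing (false ∷ w) ms × N * M ≤ dictSize ms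
  parse-0w M fits with Parser₀.parsing (Ready.valid (ready-lines h ready-preamble₀)) (E N)
  ... | ms , parse , complete = ms ,
    subst (λ u → IsLZ78Parsing (u ++ seg t 0 (E N)) ms) (lines-flatten-0∷ h refl) parse ,
    many-blocks {M} fits complete

-- The word x

-- X is a sequence of frames 0110 e(a) 0 e(b) of length f, where e(c) has length K and its only 1 at index c; the frame
-- number τ carries a = τ / K and b = τ % K.
module Frames (K : ℕ) .{{_ : NonZero K}} where

  f : ℕ
  f = 5 + (K + K)

  -- Reducing `high` modulo `K` keeps frames well formed also for τ ≥ K².
  high low : ℕ → ℕ
  high τ = (τ / K) % K
  low τ = τ % K

  One : ℕ → ℕ → Set
  One r τ = (r ≡ 1) ⊎ (r ≡ 2) ⊎ (r ≡ 4 + high τ) ⊎ (r ≡ 5 + K + low τ)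

  One? : ∀ r τ → Dec (One r τ)
  One? r τ = (r ≟ 1) ⊎-dec ((r ≟ 2) ⊎-dec ((r ≟ 4 + high τ) ⊎-dec (r ≟ 5 + K + low τ)))

  x : ℕ → Bool
  x p = does (One? (p % f) (p / f))

  frame-% : ∀ {r} τ → r < f → (r + τ * f) % f ≡ r
  frame-% {r} τ r<f = trans ([m+kn]%n≡m%n r τ f) (m<n⇒m%n≡m r<f)

  frame-/ : ∀ {r} τ → r < f → (r + τ * f) / f ≡ τ
  frame-/ {r} τ r<f = trans (+-distrib-/-∣ʳ r (n∣m*n τ)) (trans (cong₂ _+_ (m<n⇒m/n≡0 r<f) (m*n/n≡m τ f)) refl)

  true⇒One : ∀ {r} τ → r < f → x (r + τ * f) ≡ true → One r τ
  true⇒One {r} τ r<f eq = subst₂ One (frame-% τ r<f) (frame-/ τ r<f) (witness (One? _ _) eq)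
    where
    witness : ∀ {P : Set} (P? : Dec P) → does P? ≡ true → P
    witness (yes p) _ = p

  One⇒true : ∀ {r} τ → r < f → One r τ → x (r + τ * f) ≡ true
  One⇒true {r} τ r<f one = dec-true (One? _ _) (subst₂ One (sym (frame-% τ r<f)) (sym (frame-/ τ r<f)) one)

  ¬One-0 : ∀ {τ} → ¬ One 0 τ
  ¬One-0 (inj₂ (inj₂ (inj₁ ())))
  ¬One-0 (inj₂ (inj₂ (inj₂ ())))

  high<K : ∀ τ → high τ < K
  high<K τ = m%n<n (τ / K) K

  low<K : ∀ τ → low τ < K
  low<K τ = m%n<n τ K

  apart : ∀ {τ τ′} → 4 + high τ ≢ 5 + K + low τ′
  apart {τ} {τ′} eq = <⇒≢ (<-≤-trans (+-monoʳ-< 4 (high<K τ)) (≤-trans (n≤1+n _) (m≤m+n (5 + K) (low τ′)))) eq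

  -- The zeros at positions 3 and 4 + K of a frame isolate its last two ones from all others.
  11-flag : ∀ {r τ} → One r τ → One (suc r) τ → r ≡ 1
  11-flag (inj₁ r≡1) _ = r≡1
  11-flag (inj₂ (inj₁ refl)) (inj₂ (inj₂ (inj₁ ())))
  11-flag (inj₂ (inj₁ refl)) (inj₂ (inj₂ (inj₂ ())))
  11-flag (inj₂ (inj₂ (inj₁ refl))) (inj₂ (inj₂ (inj₁ eq))) = ⊥-elim (1+n≢n eq)
  11-flag {τ = τ} (inj₂ (inj₂ (inj₁ refl))) (inj₂ (inj₂ (inj₂ eq))) =
    ⊥-elim (<⇒≢ (<-≤-trans (+-monoʳ-< 5 (high<K τ)) (m≤m+n (5 + K) (low τ))) eq)
  11-flag {τ = τ} (inj₂ (inj₂ (inj₂ refl))) (inj₂ (inj₂ (inj₁ eq))) =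
    ⊥-elim (<⇒≢ (<-≤-trans (+-monoʳ-< 4 (high<K τ)) (≤-trans (m≤n+m _ 2) (m≤m+n (6 + K) (low τ)))) (sym eq))
  11-flag (inj₂ (inj₂ (inj₂ refl))) (inj₂ (inj₂ (inj₂ eq))) = ⊥-elim (1+n≢n eq)
  11-flag (inj₂ (inj₁ refl)) (inj₁ ())
  11-flag (inj₂ (inj₁ refl)) (inj₂ (inj₁ ()))
  11-flag (inj₂ (inj₂ (inj₁ refl))) (inj₁ ())
  11-flag (inj₂ (inj₂ (inj₁ refl))) (inj₂ (inj₁ ()))
  11-flag (inj₂ (inj₂ (inj₂ refl))) (inj₁ ())
  11-flag (inj₂ (inj₂ (inj₂ refl))) (inj₂ (inj₁ ()))

  -- Every frame begins with 0, so no 11 straddles two frames.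
  flag : ∀ {p} → x p ≡ true → x (suc p) ≡ true → ∃ λ τ → p ≡ 1 + τ * f
  flag {p} xp xp′ = τ , trans p≡ (cong (_+ τ * f) (r≡1 (m≤n⇒m<n∨m≡n (m%n<n p f))))
    where
    r = p % f
    τ = p / f
    p≡ : p ≡ r + τ * f
    p≡ = m≡m%n+[m/n]*n p f
    one : One r τ
    one = true⇒One τ (m%n<n p f) (trans (cong x (sym p≡)) xp)
    r≡1 : suc r < f ⊎ suc r ≡ f → r ≡ 1
    r≡1 (inj₁ 1+r<f) = 11-flag {τ = τ} one (true⇒One τ 1+r<f (trans (cong x (cong suc (sym p≡))) xp′))
    r≡1 (inj₂ 1+r≡f) = ⊥-elim (¬One-0 (true⇒One (suc τ) (s≤s z≤n)
      (trans (cong x (trans (cong (_+ τ * f) (sym 1+r≡f)) (cong suc (sym p≡)))) xp′)))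

  2<f : 2 < f
  2<f = s≤s (s≤s (s≤s z≤n))

  no-111 : ∀ {p} → x p ≡ true → x (1 + p) ≡ true → x (2 + p) ≡ true → ⊥
  no-111 {p} x₀ x₁ x₂ with flag {p} x₀ x₁ | flag {suc p} x₁ x₂
  ... | τ , p≡ | τ′ , 1+p≡
    with trans (sym (frame-% τ′ (<-trans (n<1+n 1) 2<f))) (trans (cong (_% f) (trans (sym 1+p≡) (cong suc p≡))) (frame-% τ 2<f))
  ... | ()

  next-flag : ∀ p → ∃₂ λ o τ → o < f × p + o ≡ 1 + τ * f
  next-flag p with p % f | m≡m%n+[m/n]*n p f | m%n<n p f
  ... | zero | p≡ | _ = 1 , p / f , <-trans (n<1+n 1) 2<f , trans (+-comm p 1) (cong suc p≡)
  ... | suc zero | p≡ | _ = 0 , p / f , s≤s z≤n , trans (+-identityʳ p) p≡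
  ... | suc (suc r) | p≡ | r<f with m≤n⇒∃[o]m+o≡n (<⇒≤ r<f)
  ... | o , eq = suc o , suc (p / f) , ≤-trans (s≤s (s≤s (m≤n+m o r))) (≤-reflexive eq) ,
          trans (cong (_+ suc o) p≡) (trans (shift r (p / f * f) o) (cong (λ k → suc (k + p / f * f)) eq))
    where
    shift : ∀ r y o → suc (suc r) + y + suc o ≡ suc (suc (suc r) + o + y)
    shift r y o = solve (r ∷ y ∷ o ∷ [])

  coordinates : ∀ {τ τ′} → τ < K * K → τ′ < K * K → high τ ≡ high τ′ → low τ ≡ low τ′ → τ ≡ τ′
  coordinates {τ} {τ′} τ< τ′< h≡ l≡ = begin
    τ                       ≡⟨ m≡m%n+[m/n]*n τ K ⟩
    low τ + τ / K * K       ≡⟨ cong₂ (λ l h → l + h * K) l≡ (trans (sym (small τ<)) (trans h≡ (small τ′<))) ⟩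
    low τ′ + τ′ / K * K     ≡⟨ m≡m%n+[m/n]*n τ′ K ⟨
    τ′                      ∎
    where
    open ≡-Reasoning
    small : ∀ {τ} → τ < K * K → high τ ≡ τ / K
    small {τ} τ< = m<n⇒m%n≡m (m<n*o⇒m/o<n τ<)

  -- Fewer than `f` letters after `p` comes a flag 11, and the rest of its frame fits into the `2f`
  -- letters. The copy at `q` has a flag at the same distance and the same two indices; below
  -- `bound` these determine the frame.
  unique : ∀ {bound} → bound + f ≤ K * K * f →
    ∀ {p q} → p < bound → q < bound → (∀ {r} → r < f + f → x (p + r) ≡ x (q + r)) → p ≡ q
  unique {bound} b≤ {p} {q} p< q< letters with next-flag p
  ... | o , τ , o<f , p+o≡ = same (flag (trans (cong x (sym (+-identityʳ (q + o)))) (copy 1<f (inj₁ refl)))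
          (trans (cong x (+-comm 1 (q + o))) (copy 2<f (inj₂ (inj₁ refl)))))
    where
    1<f : 1 < f
    1<f = <-trans (n<1+n 1) 2<f

    rotate : ∀ y s → suc y + s ≡ suc s + y
    rotate y s = cong suc (+-comm y s)

    copy : ∀ {s} → 1 + s < f → One (1 + s) τ → x (q + o + s) ≡ true
    copy {s} 1+s<f one = begin
      x (q + o + s)        ≡⟨ cong x (+-assoc q o s) ⟩
      x (q + (o + s))      ≡⟨ letters (+-mono-< o<f (<-trans (n<1+n s) 1+s<f)) ⟨
      x (p + (o + s))      ≡⟨ cong x (+-assoc p o s) ⟨
      x (p + o + s)        ≡⟨ cong x (trans (cong (_+ s) p+o≡) (rotate (τ * f) s)) ⟩
      x (1 + s + τ * f)    ≡⟨ One⇒true τ 1+s<f one ⟩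
      true                 ∎
      where open ≡-Reasoning

    frame-number : ∀ {y τ} → y < bound → y + o ≡ 1 + τ * f → τ < K * K
    frame-number {y} {τ} y<bound y+o≡ = *-cancelʳ-< f τ (K * K)
      (≤-trans (≤-reflexive (sym y+o≡)) (≤-trans (+-mono-≤ (<⇒≤ y<bound) (<⇒≤ o<f)) b≤))

    same : (∃ λ τ′ → q + o ≡ 1 + τ′ * f) → p ≡ q
    same (τ′ , q+o≡) = +-cancelʳ-≡ o p q (trans p+o≡ (trans (cong (λ k → 1 + k * f) τ≡) (sym q+o≡)))
      where
      copied : ∀ {s} → 1 + s < f → One (1 + s) τ → One (1 + s) τ′
      copied {s} 1+s<f one = true⇒One τ′ 1+s<f
        (trans (cong x (sym (trans (cong (_+ s) q+o≡) (rotate (τ′ * f) s)))) (copy 1+s<f one))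

      high≡ : high τ ≡ high τ′
      high≡ with copied {3 + high τ} (s≤s (+-monoʳ-≤ 4 (≤-trans (<⇒≤ (high<K τ)) (m≤m+n K K)))) (inj₂ (inj₂ (inj₁ refl)))
      ... | inj₂ (inj₂ (inj₁ eq)) = +-cancelˡ-≡ 4 _ _ eq
      ... | inj₂ (inj₂ (inj₂ eq)) = ⊥-elim (apart {τ} {τ′} eq)

      low≡ : low τ ≡ low τ′
      low≡ with copied {4 + K + low τ} (+-monoʳ-< (5 + K) (low<K τ)) (inj₂ (inj₂ (inj₂ refl)))
      ... | inj₂ (inj₂ (inj₁ eq)) = ⊥-elim (apart {τ′} {τ} (sym eq))
      ... | inj₂ (inj₂ (inj₂ eq)) = +-cancelˡ-≡ (5 + K) _ _ eq

      τ≡ : τ ≡ τ′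
      τ≡ = coordinates (frame-number p< p+o≡) (frame-number q< q+o≡) high≡ low≡

-- Parameters

^-distribʳ-* : ∀ k m n → (m * n) ^ k ≡ m ^ k * n ^ k
^-distribʳ-* zero    m n = refl
^-distribʳ-* (suc k) m n = trans (cong (m * n *_) (^-distribʳ-* k m n)) ([m*n]*[o*p]≡[m*o]*[n*p] m n (m ^ k) (n ^ k))

-- Splits the estimate into a numerical comparison of constants and the common scale `q`, later K².
square-estimate : ∀ a b m n q {d l} → a * m ^ 2 ≤ b * n → d ≤ m * q → n * (q * q) ≤ l → a * d ^ 2 ≤ b * l
square-estimate a b m n q {d} {l} const d≤ l≥ = begin
  a * d ^ 2               ≤⟨ *-monoʳ-≤ a (^-monoˡ-≤ 2 d≤) ⟩
  a * (m * q) ^ 2         ≡⟨ cong (a *_) (^-distribʳ-* 2 m q) ⟩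
  a * (m ^ 2 * q ^ 2)     ≡⟨ *-assoc a (m ^ 2) (q ^ 2) ⟨
  a * m ^ 2 * q ^ 2       ≤⟨ *-monoˡ-≤ (q ^ 2) const ⟩
  b * n * q ^ 2           ≡⟨ *-assoc b n (q ^ 2) ⟩
  b * (n * q ^ 2)         ≡⟨ cong (λ y → b * (n * (q * y))) (*-identityʳ q) ⟩
  b * (n * (q * q))       ≤⟨ *-monoʳ-≤ b l≥ ⟩
  b * l                   ∎
  where open ≤-Reasoning

-- The scales `q` and `r` become K⁴ for |w| and K³ for |Dict(0w)|, whence `q ^ 3 ≡ r ^ 4`.
power-estimate : ∀ a b m n q r {d l} → a * m ^ 3 ≤ b * n ^ 4 → q ^ 3 ≡ r ^ 4 → l ≤ m * q → n * r ≤ d →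
  a * l ^ 3 ≤ b * d ^ 4
power-estimate a b m n q r {d} {l} const q³≡r⁴ l≤ d≥ = begin
  a * l ^ 3               ≤⟨ *-monoʳ-≤ a (^-monoˡ-≤ 3 l≤) ⟩
  a * (m * q) ^ 3         ≡⟨ cong (a *_) (^-distribʳ-* 3 m q) ⟩
  a * (m ^ 3 * q ^ 3)     ≡⟨ *-assoc a (m ^ 3) (q ^ 3) ⟨
  a * m ^ 3 * q ^ 3       ≤⟨ *-mono-≤ const (≤-reflexive q³≡r⁴) ⟩
  b * n ^ 4 * r ^ 4       ≡⟨ *-assoc b (n ^ 4) (r ^ 4) ⟩
  b * (n ^ 4 * r ^ 4)     ≡⟨ cong (b *_) (^-distribʳ-* 4 n r) ⟨
  b * (n * r) ^ 4         ≤⟨ *-monoʳ-≤ b (^-monoˡ-≤ 4 d≥) ⟩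
  b * d ^ 4               ∎
  where open ≤-Reasoning

-- The parameters are n₁ = 3 + 100K², R = 4K (so n₂ = 16K²), A = 2f = 10 + 4K, and 2K windows in each later line.
module Estimates (K : ℕ) (60≤K : 60 ≤ K) where

  Q A B : ℕ
  Q = K * K
  A = 5 + (K + K) + (5 + (K + K))
  B = A + A

  60K≤Q : 60 * K ≤ K * K
  60K≤Q = *-monoˡ-≤ K 60≤K

  3600≤Q : 3600 ≤ Q
  3600≤Q = *-mono-≤ 60≤K 60≤K

  1≤R : 1 ≤ 4 * K
  1≤R = ≤-trans (s≤s z≤n) (≤-trans 60≤K (m≤n*m K 4))

  A≤n₁ : A ≤ 3 + 100 * Q
  A≤n₁ = linear (99 * (K * K) + 55 * K + 53) (+-mono-≤ 60K≤Q 60≤K) (eq K)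
    where
    eq : ∀ K → 5 + (K + K) + (5 + (K + K)) + (K * K + K) + (99 * (K * K) + 55 * K + 53) ≡ 3 + 100 * (K * K) + (60 * K + 60)
    eq K = solve (K ∷ [])

  in-bound : 3 + 100 * Q + 4 * K * (4 * K) + A < 117 * Q
  in-bound = linear (55 * K + 46) (+-mono-≤ 60K≤Q 60≤K) (eq K)
    where
    eq : ∀ K → suc (3 + 100 * (K * K) + 4 * K * (4 * K) + (5 + (K + K) + (5 + (K + K)))) + (K * K + K) + (55 * K + 46)
      ≡ 117 * (K * K) + (60 * K + 60)
    eq K = solve (K ∷ [])

  -- For K ≥ 60 a frame has at least 125 letters, so K² frames reach beyond 117 K² by more than one
  -- frame.
  bound≤ : 117 * Q + (5 + (K + K)) ≤ Q * (5 + (K + K))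
  bound≤ = linear (7 * (K * K) + 57 * K + 55)
      (+-mono-≤ (*-monoʳ-≤ (2 * (K * K)) 60≤K) (+-mono-≤ 60K≤Q 60≤K)) (eq K)
    where
    eq : ∀ K → 117 * (K * K) + (5 + (K + K)) + (2 * (K * K) * K + (K * K + K)) + (7 * (K * K) + 57 * K + 55)
      ≡ K * K * (5 + (K + K)) + (2 * (K * K) * 60 + (60 * K + 60))
    eq K = solve (K ∷ [])

  -- The leading terms are 3 · 16 K² + 2K · 24 K = 96 K², which leaves 4 K² for the lower-order
  -- ones.
  fits : let B+N = B + 4 * K * (4 * K) in
    B+N + B+N + 2 * K * (B + (B + 4 * K + 4 * K)) + B+N ≤ 3 + 100 * Q
  fits = linear (135 * K + 3) (+-mono-≤ (*-monoʳ-≤ 4 60K≤Q) 60≤K) (eq K)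
    where
    eq : ∀ K → let A = 5 + (K + K) + (5 + (K + K)) ; B = A + A ; B+N = B + 4 * K * (4 * K) in
      B+N + B+N + 2 * K * (B + (B + 4 * K + 4 * K)) + B+N + (4 * (K * K) + K) + (135 * K + 3)
      ≡ 3 + 100 * (K * K) + (4 * (60 * K) + 60)
    eq K = solve (K ∷ [])

  length-lower : ∀ {l e} → 2 * l ≡ (3 + 100 * Q) * (4 + 100 * Q) + 12 → 4 * K * (4 * K) * (3 + 100 * Q) ≤ e →
    6600 * (Q * Q) ≤ l + e
  length-lower {l} {e} 2l≡ e≥ = ≤-trans (≤-reflexive (*-distribʳ-+ (Q * Q) 5000 1600)) (+-mono-≤
      (*-cancelˡ-≤ {5000 * (Q * Q)} {l} 2 (≤-trans (m≤m+n _ (700 * Q + 24)) (≤-reflexive (trans (eq Q) (sym 2l≡)))))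
      (≤-trans (≤-trans (m≤m+n _ (48 * Q)) (≤-reflexive (eq′ K))) e≥))
    where
    eq : ∀ Q → 2 * (5000 * (Q * Q)) + (700 * Q + 24) ≡ (3 + 100 * Q) * (4 + 100 * Q) + 12
    eq Q = solve (Q ∷ [])
    eq′ : ∀ K → 1600 * (K * K * (K * K)) + 48 * (K * K) ≡ 4 * K * (4 * K) * (3 + 100 * (K * K))
    eq′ K = solve (K ∷ [])

  -- The leading coefficients 5000 and 16 · (100 + 32) = 2112 are each raised by one to absorb the
  -- lower-order terms.
  length-upper : ∀ {l e} → 2 * l ≡ (3 + 100 * Q) * (4 + 100 * Q) + 12 →
    (let N = 4 * K * (4 * K) in e ≤ N * (3 + 100 * Q + (N + N) + 5)) →
    l + e ≤ 7114 * (Q * Q)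
  length-upper {l} {e} 2l≡ e≤ = ≤-trans (+-mono-≤
      (*-cancelˡ-≤ {l} {5001 * (Q * Q)} 2 (≤-trans (≤-reflexive 2l≡)
        (linear (6499 * Q + 3576) (+-mono-≤ (*-monoʳ-≤ (2 * Q) 3600≤Q) 3600≤Q) (eq Q))))
      (≤-trans e≤ (linear (3472 * (K * K)) (*-monoʳ-≤ Q 3600≤Q) (eq′ K))))
    (≤-reflexive (sym (*-distribʳ-+ (Q * Q) 5001 2113)))
    where
    eq : ∀ Q → (3 + 100 * Q) * (4 + 100 * Q) + 12 + (2 * Q * Q + Q) + (6499 * Q + 3576) ≡ 2 * (5001 * (Q * Q)) + (2 * Q * 3600 + 3600)
    eq Q = solve (Q ∷ [])
    eq′ : ∀ K → let N = 4 * K * (4 * K) in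
      N * (3 + 100 * (K * K) + (N + N) + 5) + K * K * (K * K) + 3472 * (K * K) ≡ 2113 * (K * K * (K * K)) + K * K * 3600
    eq′ K = solve (K ∷ [])

  few-blocks : ∀ {d l} → d ≤ 100 * Q + 6 + (4 * K * (4 * K) + 4 * K * (4 * K)) → 6600 * (Q * Q) ≤ l → 100 * d ^ 2 ≤ 361 * l
  few-blocks d≤ = square-estimate 100 361 133 6600 Q (≤ᵇ⇒≤ (100 * 133 ^ 2) (361 * 6600) tt)
      (≤-trans d≤ (linear 3594 3600≤Q (eq K)))
    where
    eq : ∀ K → 100 * (K * K) + 6 + (4 * K * (4 * K) + 4 * K * (4 * K)) + K * K + 3594 ≡ 133 * (K * K) + 3600
    eq K = solve (K ∷ [])

  many-blocks-suffice : ∀ {d l} → 4 * K * (4 * K) * (2 * K) ≤ d → l ≤ 7114 * (Q * Q) → 39 ^ 4 * l ^ 3 ≤ 1000 ^ 4 * d ^ 4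
  many-blocks-suffice d≥ l≤ = power-estimate (39 ^ 4) (1000 ^ 4) 7114 32 (Q * Q) (Q * K)
      (≤ᵇ⇒≤ (39 ^ 4 * 7114 ^ 3) (1000 ^ 4 * 32 ^ 4) tt) (eq K) l≤ (≤-trans (≤-reflexive (eq′ K)) d≥)
    where
    eq : ∀ K → (K * K * (K * K)) * ((K * K * (K * K)) * ((K * K * (K * K)) * 1))
      ≡ K * K * K * (K * K * K * (K * K * K * (K * K * K * 1)))
    eq K = solve (K ∷ [])
    eq′ : ∀ K → 32 * (K * K * K) ≡ 4 * K * (4 * K) * (2 * K)
    eq′ K = solve (K ∷ [])

-- The bounds for the constructed words

-- The two bounds are squared and raised to the fourth power, with 1.9² = 361/100 and 0.039⁴ =
-- 39⁴/1000⁴, to stay within the natural numbers.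
catastrophe : ∀ K .{{_ : NonZero K}} → 60 ≤ K → ∃ λ (w : Word) →
    K ≤ length w
    × (∃ λ ms → IsLZ78Parsing w ms
         × 100 * (dictSize ms ^ 2) ≤ 361 * length w)
    × (∃ λ ms′ → IsLZ78Parsing (false ∷ w) ms′
         × (39 ^ 4) * (length w ^ 3) ≤ (1000 ^ 4) * (dictSize ms′ ^ 4))
catastrophe K 60≤K = w , K≤ ,
    (proj₁ parse-w , proj₁ (proj₂ parse-w) ,
      few-blocks {dictSize (proj₁ parse-w)} {length w} (proj₂ (proj₂ parse-w)) lower) ,
    (proj₁ parsed , proj₁ (proj₂ parsed) ,
      many-blocks-suffice {dictSize (proj₁ parsed)} {length w} (proj₂ (proj₂ parsed)) upper)
  where
  open Estimates K 60≤K using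
    (Q; A; 1≤R; A≤n₁; in-bound; bound≤; fits; length-lower; length-upper; few-blocks; many-blocks-suffice)
  open Frames K using (x; no-111; unique)
  open Analysis x refl refl refl refl (λ {p} → no-111 {p}) A (117 * Q) (s≤s (s≤s (s≤s z≤n))) (unique bound≤)
    (100 * Q) (4 * K) 1≤R A≤n₁ in-bound
  open Construction x refl refl refl refl (λ {p} → no-111 {p}) (100 * Q) using (E-lower; E-upper)
  parsed = parse-0w (2 * K) fits
  lower : 6600 * (Q * Q) ≤ length w
  lower = ≤-trans (length-lower (proj₁ (proj₂ w-length)) (E-lower N)) (≤-reflexive (sym (proj₂ (proj₂ w-length))))
  upper : length w ≤ 7114 * (Q * Q)
  upper = ≤-trans (≤-reflexive (proj₂ (proj₂ w-length))) (length-upper (proj₁ (proj₂ w-length)) (E-upper N ≤-refl))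
  K≤ : K ≤ length w
  K≤ = ≤-trans (m≤m*n K K) (≤-trans (m≤m*n Q Q {{m*n≢0 K K}}) (≤-trans (m≤n*m (Q * Q) 6600) lower))

mainTheorem5 : ∀ (N : ℕ) → ∃ λ (w : Word) →
    N ≤ length w
    × (∃ λ ms → IsLZ78Parsing w ms
         × 100 * (dictSize ms ^ 2) ≤ 361 * length w)
    × (∃ λ ms′ → IsLZ78Parsing (false ∷ w) ms′
         × (39 ^ 4) * (length w ^ 3) ≤ (1000 ^ 4) * (dictSize ms′ ^ 4))
mainTheorem5 n = proj₁ result , ≤-trans (m≤n+m n 60) (proj₁ (proj₂ result)) , proj₂ (proj₂ result)
  where
  result = catastrophe (60 + n) (m≤m+n 60 n)
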